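{- Let $A$ be a finite skew brace such that $\Lambda(A)$ has exactly one vertex and $\ker\lambda\cap\operatorname{Fix}(A)=\{0\}$. Then $(\operatorname{Fix}(A),+)$ is an abelian group of odd order, $\operatorname{Fix}(A)$ is a trivial skew brace, and $A$ is isomorphic to the skew brace on $\operatorname{Fix}(A)\times\mathbb{Z}/2\mathbb{Z}$ with operations \[(f_1,k_1)+(f_2,k_2)=\big(f_1+(-1)^{k_1}f_2,\,k_1+k_2\big),\qquad (f_1,k_1)\circ(f_2,k_2)=\big((-1)^{k_2}f_1+(-1)^{k_1}f_2,\,k_1+k_2\big).\] Conversely, if $F$ is a non-trivial abelian group of odd order, then $A=F\times\mathbb{Z}/2\mathbb{Z}$ with these operations is a skew brace with $\operatorname{Fix}(A)=F\times\{0\}$, $\ker\lambda=\{0\}\times\mathbb{Z}/2\mathbb{Z}$, and $\Lambda(A)$ has exactly one vertex.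
   Context: A skew brace is a triple $(A,+,\circ)$ where $(A,+)$ and $(A,\circ)$ are groups with $a\circ(b+c)=a\circ b-a+a\circ c$. $\lambda_a(b)=-a+a\circ b$ gives a homomorphism $\lambda\colon(A,\circ)\to\operatorname{Aut}(A,+)$ with kernel $\ker\lambda$. $\operatorname{Fix}(A)=\{a\in A:\lambda_x(a)=a\ \forall x\in A\}$. A trivial skew brace is one with $a+b=a\circ b$ for all $a,b$. $\Lambda(A)$ is the graph whose vertices are the $\lambda$-orbits of size $>1$, two distinct vertices $L_1,L_2$ adjacent iff $\gcd(|L_1|,|L_2|)\ne1$. -}

module Defs where

open import Level using (Level; _⊔_) renaming (suc to lsuc)
open import Algebra.Bundles using (Group)
open import Algebra.Bundles.Raw using (RawGroup)
open import Algebra.Structures using (IsGroup)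
open import Algebra.Morphism.Structures using (module GroupMorphisms)
import Algebra.Properties.Group as GroupProperties
open import Data.Fin.Base using (Fin)
open import Data.Fin.Permutation using (↔⇒≡)
open import Data.Nat.Base as ℕ using (ℕ)
open import Data.Nat.Divisibility using (_∣_)
open import Data.Nat.GCD using (gcd; gcd-comm)
open import Data.Parity.Base as ℙ using (Parity; 0ℙ; 1ℙ)
open import Data.Product using (Σ; ∃; ∃-syntax; _×_; _,_; proj₁; proj₂)
open import Data.Product.Relation.Binary.Pointwise.NonDependent using (Pointwise)
open import Function.Bundles using (Inverse)
open import Function.Construct.Composition using (inverse)
open import Function.Construct.Symmetry using () renaming (inverse to symInverse)
open import Relation.Binary.Bundles using (Setoid)
open import Relation.Binary.Core using (Rel)
open import Relation.Binary.Definitions using (Symmetric; Irreflexive; _Respects₂_)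
import Relation.Binary.Construct.On as On
open import Relation.Binary.PropositionalEquality as ≡ using (_≡_)
import Relation.Binary.Reasoning.Setoid as SetoidReasoning
open import Relation.Nullary.Negation using (¬_)
open import Relation.Unary using (Pred; _≐_)
open import Relation.Unary.Properties using (≐-refl; ≐-sym; ≐-trans)

private variable
  c c′ ℓ ℓ′ p q : Level

------------------------------------------------------------------------
-- Cardinality

HasCardinality : Setoid c ℓ → ℕ → Set (c ⊔ ℓ)
HasCardinality S n = Inverse S (≡.setoid (Fin n))

Finite : Setoid c ℓ → Set (c ⊔ ℓ)
Finite S = ∃[ n ] HasCardinality S n

HasOddOrder : Setoid c ℓ → Set (c ⊔ ℓ)
HasOddOrder S = ∃[ n ] HasCardinality S n × ¬ (2 ∣ n)

subsetoid : (S : Setoid c ℓ) → Pred (Setoid.Carrier S) p → Setoid (c ⊔ p) ℓ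
subsetoid S P = On.setoid {B = Σ (Setoid.Carrier S) P} S proj₁

cardinality-unique : (S : Setoid c ℓ) {P : Pred (Setoid.Carrier S) p} {Q : Pred (Setoid.Carrier S) q} →
                     P ≐ Q → ∀ {m n} →
                     HasCardinality (subsetoid S P) m →
                     HasCardinality (subsetoid S Q) n → m ≡ n
cardinality-unique S {P} {Q} (P⊆Q , Q⊆P) P↔m Q↔n =
  ↔⇒≡ (inverse (symInverse P↔m) (inverse P↔Q Q↔n))
  where
  P↔Q : Inverse (subsetoid S P) (subsetoid S Q)
  P↔Q = record
    { to        = λ (x , x∈P) → x , P⊆Q x∈P
    ; from      = λ (x , x∈Q) → x , Q⊆P x∈Q
    ; to-cong   = λ x≈y → x≈y
    ; from-cong = λ x≈y → x≈y
    ; inverse   = (λ x≈y → x≈y) , (λ x≈y → x≈y)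
    }

------------------------------------------------------------------------
-- Simple graphs

record Graph v ℓ e : Set (lsuc (v ⊔ ℓ ⊔ e)) where
  field
    vertices : Setoid v ℓ
  open Setoid vertices public renaming (Carrier to Vertex)
  field
    Adjacent   : Rel Vertex e
    adj-sym    : Symmetric Adjacent
    adj-irrefl : Irreflexive _≈_ Adjacent
    adj-resp   : Adjacent Respects₂ _≈_

HasExactlyOneVertex : ∀ {v e} → Graph v ℓ e → Set (v ⊔ ℓ)
HasExactlyOneVertex Γ = ∃[ v ] ∀ w → w ≈ v
  where open Graph Γ

------------------------------------------------------------------------
-- Skew braces

record RawSkewBrace c ℓ : Set (lsuc (c ⊔ ℓ)) where
  infix  8 -_ _⁻¹
  infixl 7 _∘_
  infixl 6 _+_
  infix  4 _≈_
  field
    Carrier : Set c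
    _≈_     : Rel Carrier ℓ
    _+_     : Carrier → Carrier → Carrier
    0#      : Carrier
    -_      : Carrier → Carrier
    _∘_     : Carrier → Carrier → Carrier
    1#      : Carrier
    _⁻¹     : Carrier → Carrier

  +-rawGroup : RawGroup c ℓ
  +-rawGroup = record { _≈_ = _≈_ ; _∙_ = _+_ ; ε = 0# ; _⁻¹ = -_ }

  ∘-rawGroup : RawGroup c ℓ
  ∘-rawGroup = record { _≈_ = _≈_ ; _∙_ = _∘_ ; ε = 1# ; _⁻¹ = _⁻¹ }

record IsSkewBrace (R : RawSkewBrace c ℓ) : Set (c ⊔ ℓ) where
  open RawSkewBrace R
  field
    +-isGroup : IsGroup _≈_ _+_ 0# -_
    ∘-isGroup : IsGroup _≈_ _∘_ 1# _⁻¹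
    brace     : ∀ x y z → x ∘ (y + z) ≈ x ∘ y + - x + x ∘ z

record SkewBrace c ℓ : Set (lsuc (c ⊔ ℓ)) where
  constructor mkSkewBrace
  field
    raw         : RawSkewBrace c ℓ
    isSkewBrace : IsSkewBrace raw
  open RawSkewBrace raw public
  open IsSkewBrace isSkewBrace public

  +-group : Group c ℓ
  +-group = record { isGroup = +-isGroup }

  ∘-group : Group c ℓ
  ∘-group = record { isGroup = ∘-isGroup }

  open Group +-group public using (setoid; refl; sym; trans)

  lam : Carrier → Carrier → Carrier
  lam x y = - x + x ∘ y

  Ker-lam : Pred Carrier (c ⊔ ℓ)
  Ker-lam x = ∀ y → lam x y ≈ y

  Fix : Pred Carrier (c ⊔ ℓ)
  Fix y = ∀ x → lam x y ≈ y

  Orbit : Carrier → Pred Carrier (c ⊔ ℓ)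
  Orbit y z = ∃[ x ] lam x y ≈ z

  IsTrivial : Set (c ⊔ ℓ)
  IsTrivial = ∀ x y → x + y ≈ x ∘ y

  -- Recording the size is harmless: it is unique, and is ignored by the
  -- equality of vertices.
  record NontrivialOrbit : Set (lsuc (c ⊔ ℓ)) where
    field
      elements : Pred Carrier (c ⊔ ℓ)
      isOrbit  : ∃[ y ] elements ≐ Orbit y
      size     : ℕ
      hasSize  : HasCardinality (subsetoid setoid elements) size
      1<size   : 1 ℕ.< size

  open NontrivialOrbit

  Λ : Graph (lsuc (c ⊔ ℓ)) (c ⊔ ℓ) (c ⊔ ℓ)
  Λ = record
    { vertices = record
      { Carrier       = NontrivialOrbit
      ; _≈_           = λ L₁ L₂ → elements L₁ ≐ elements L₂
      ; isEquivalence = record { refl = ≐-refl ; sym = ≐-sym ; trans = ≐-trans }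
      }
    ; Adjacent   = λ L₁ L₂ → ¬ (elements L₁ ≐ elements L₂) × ¬ (gcd (size L₁) (size L₂) ≡ 1)
    ; adj-sym    = λ {L₁} {L₂} (L₁≠L₂ , gcd≢1) →
        (λ L₂=L₁ → L₁≠L₂ (≐-sym L₂=L₁)) ,
        (λ gcd≡1 → gcd≢1 (≡.trans (gcd-comm (size L₁) (size L₂)) gcd≡1))
    ; adj-irrefl = λ L₁=L₂ (L₁≠L₂ , _) → L₁≠L₂ L₁=L₂
    ; adj-resp   =
        (λ {L} {M} {N} M=N (L≠M , gcd≢1) →
          (λ L=N → L≠M (≐-trans L=N (≐-sym M=N))) ,
          (λ gcd≡1 → gcd≢1 (≡.trans (≡.cong (gcd (size L)) (size-cong M N M=N)) gcd≡1))) ,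
        (λ {L} {M} {N} M=N (M≠L , gcd≢1) →
          (λ N=L → M≠L (≐-trans M=N N=L)) ,
          (λ gcd≡1 → gcd≢1 (≡.trans (≡.cong (λ s → gcd s (size L)) (size-cong M N M=N)) gcd≡1)))
    }
    where
    size-cong : ∀ L M → elements L ≐ elements M → size L ≡ size M
    size-cong L M L=M = cardinality-unique setoid L=M (hasSize L) (hasSize M)

_≅_ : SkewBrace c ℓ → SkewBrace c′ ℓ′ → Set (c ⊔ ℓ ⊔ c′ ⊔ ℓ′)
A ≅ B = ∃[ f ] +.IsGroupIsomorphism f × ∘.IsGroupIsomorphism f
  where
  module + = GroupMorphisms (SkewBrace.+-rawGroup A) (SkewBrace.+-rawGroup B)
  module ∘ = GroupMorphisms (SkewBrace.∘-rawGroup A) (SkewBrace.∘-rawGroup B)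

------------------------------------------------------------------------
-- Fix(A) is a sub-skew-brace of A

module _ (A : SkewBrace c ℓ) where
  open SkewBrace A
  private
    module + where
      open Group +-group public
      open GroupProperties +-group public
    module ∘ where
      open Group ∘-group public
      open GroupProperties ∘-group public
    open SetoidReasoning setoid

    lam-cong : ∀ x {y z} → y ≈ z → lam x y ≈ lam x z
    lam-cong x y≈z = +.∙-congˡ (∘.∙-congˡ y≈z)

    lam-+ : ∀ x y z → lam x (y + z) ≈ lam x y + lam x z
    lam-+ x y z = begin
      - x + x ∘ (y + z)             ≈⟨ +.∙-congˡ (brace x y z) ⟩
      - x + (x ∘ y + - x + x ∘ z)   ≈⟨ +.∙-congˡ (+.assoc _ _ _) ⟩
      - x + (x ∘ y + (- x + x ∘ z)) ≈⟨ +.assoc _ _ _ ⟨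
      lam x y + lam x z             ∎

    lam-0 : ∀ x → lam x 0# ≈ 0#
    lam-0 x = +.identityʳ-unique _ _ (trans (sym (lam-+ x 0# 0#)) (lam-cong x (+.identityˡ 0#)))

    lam-neg : ∀ x y → lam x (- y) ≈ - lam x y
    lam-neg x y = +.inverseʳ-unique _ _
      (trans (sym (lam-+ x y (- y))) (trans (lam-cong x (+.inverseʳ y)) (lam-0 x)))

    ∘-lam : ∀ x y → x ∘ y ≈ x + lam x y
    ∘-lam x y = sym (+.\\-leftDividesˡ x (x ∘ y))

    1≈0 : 1# ≈ 0#
    1≈0 = begin
      1#                ≈⟨ +.identityʳ 1# ⟨
      1# + 0#           ≈⟨ +.∙-congˡ (lam-0 1#) ⟨
      1# + lam 1# 0#    ≈⟨ ∘-lam 1# 0# ⟨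
      1# ∘ 0#           ≈⟨ ∘.identityˡ 0# ⟩
      0#                ∎

    Fix-resp : ∀ {y z} → y ≈ z → Fix y → Fix z
    Fix-resp y≈z fy x = trans (lam-cong x (sym y≈z)) (trans (fy x) y≈z)

    Fix-+ : ∀ {y z} → Fix y → Fix z → Fix (y + z)
    Fix-+ fy fz x = trans (lam-+ x _ _) (+.∙-cong (fy x) (fz x))

    Fix-neg : ∀ {y} → Fix y → Fix (- y)
    Fix-neg fy x = trans (lam-neg x _) (+.⁻¹-cong (fy x))

    Fix-∘ : ∀ {y z} → Fix y → Fix z → Fix (y ∘ z)
    Fix-∘ {y} {z} fy fz =
      Fix-resp (sym (trans (∘-lam y z) (+.∙-congˡ (fz y)))) (Fix-+ fy fz)

    Fix-inv : ∀ {y} → Fix y → Fix (y ⁻¹)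
    Fix-inv {y} fy = Fix-resp (∘.inverseʳ-unique y (- y) y∘-y≈1) (Fix-neg fy)
      where
      y∘-y≈1 : y ∘ (- y) ≈ 1#
      y∘-y≈1 = begin
        y ∘ (- y)       ≈⟨ ∘-lam y (- y) ⟩
        y + lam y (- y) ≈⟨ +.∙-congˡ (Fix-neg fy y) ⟩
        y + - y         ≈⟨ +.inverseʳ y ⟩
        0#              ≈⟨ 1≈0 ⟨
        1#              ∎

  fixSkewBrace : SkewBrace (c ⊔ ℓ) ℓ
  fixSkewBrace = record
    { raw = record
      { Carrier = Σ Carrier Fix
      ; _≈_     = λ (x , _) (y , _) → x ≈ y
      ; _+_     = λ (x , fx) (y , fy) → x + y , Fix-+ fx fy
      ; 0#      = 0# , lam-0
      ; -_      = λ (x , fx) → - x , Fix-neg fx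
      ; _∘_     = λ (x , fx) (y , fy) → x ∘ y , Fix-∘ fx fy
      ; 1#      = 1# , Fix-resp (sym 1≈0) lam-0
      ; _⁻¹     = λ (x , fx) → x ⁻¹ , Fix-inv fx
      }
    ; isSkewBrace = record
      { +-isGroup = record
        { isMonoid = record
          { isSemigroup = record
            { isMagma = record
              { isEquivalence = On.isEquivalence proj₁ +.isEquivalence
              ; ∙-cong        = +.∙-cong
              }
            ; assoc = λ (x , _) (y , _) (z , _) → +.assoc x y z
            }
          ; identity = (λ (x , _) → +.identityˡ x) , (λ (x , _) → +.identityʳ x)
          }
        ; inverse = (λ (x , _) → +.inverseˡ x) , (λ (x , _) → +.inverseʳ x)
        ; ⁻¹-cong = +.⁻¹-cong
        }
      ; ∘-isGroup = record
        { isMonoid = record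
          { isSemigroup = record
            { isMagma = record
              { isEquivalence = On.isEquivalence proj₁ ∘.isEquivalence
              ; ∙-cong        = ∘.∙-cong
              }
            ; assoc = λ (x , _) (y , _) (z , _) → ∘.assoc x y z
            }
          ; identity = (λ (x , _) → ∘.identityˡ x) , (λ (x , _) → ∘.identityʳ x)
          }
        ; inverse = (λ (x , _) → ∘.inverseˡ x) , (λ (x , _) → ∘.inverseʳ x)
        ; ⁻¹-cong = ∘.⁻¹-cong
        }
      ; brace = λ (x , _) (y , _) (z , _) → brace x y z
      }
    }

------------------------------------------------------------------------
-- The operations on F × ℤ/2ℤ, with ℤ/2ℤ represented by Parity

module _ (F : RawGroup c ℓ) where
  private module F = RawGroup F

  -- signed k f is (-1)ᵏ f
  signed : Parity → F.Carrier → F.Carrier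
  signed 0ℙ f = f
  signed 1ℙ f = f F.⁻¹

  -- The neutral elements and inverses are those forced by the two binary
  -- operations. Each k ∈ ℤ/2ℤ is its own negative; Data.Parity's _⁻¹ is
  -- k ↦ k + 1 and is not used.
  F×ℤ/2 : RawSkewBrace c ℓ
  F×ℤ/2 = record
    { Carrier = F.Carrier × Parity
    ; _≈_     = Pointwise F._≈_ _≡_
    ; _+_     = λ (f₁ , k₁) (f₂ , k₂) → f₁ F.∙ signed k₁ f₂ , k₁ ℙ.+ k₂
    ; 0#      = F.ε , 0ℙ
    ; -_      = λ (f , k) → signed k f F.⁻¹ , k
    ; _∘_     = λ (f₁ , k₁) (f₂ , k₂) → signed k₂ f₁ F.∙ signed k₁ f₂ , k₁ ℙ.+ k₂
    ; 1#      = F.ε , 0ℙ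
    ; _⁻¹     = λ (f , k) → f F.⁻¹ , k
    }

{-# OPTIONS --safe #-}
-- Let Fix A ∪ L = A with L the unique nontrivial orbit, and let y ∈ L. Then y + Fix A ⊆ L. If the
-- stabilizer of y in (A, ∘) were trivial then x ↦ λ_x(y) would be a bijection A → A, which is absurd;
-- so it contains some t ≠ 0, whence 2|L| ≤ |A| = |Fix A| + |L| and L = y + Fix A. Therefore t acts
-- trivially on all of A, and as ker λ ∩ Fix A = 0 it lies in L; call it e. It follows that e + e = 0
-- and ker λ = {0, e}, so e is central in (A, ∘). Write λ_x(e) = e + φ(x). Comparing x ∘ e with e ∘ x
-- gives x + e = e + ψ(x), where ψ(x) = x - φ(x). On Fix A the map φ is an injective endomorphism and
-- ψ is an involution, which forces ψ = -id. Hence Fix A is abelian, φ is doubling, and Fix A has odd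
-- order since negation fixes only 0.
--
-- Conversely λ fixes each (f, 0) and sends (f, 1) to (f ± 2g, 1), and doubling is bijective when F
-- has odd order.
module Submission where

open import Defs
open import Level using (Level)
open import Algebra.Bundles using (Group; AbelianGroup)
open import Algebra.Structures using (IsGroup; IsAbelianGroup)
open import Algebra.Morphism.Structures using (module GroupMorphisms)
import Algebra.Properties.AbelianGroup as AbelianGroupProperties
import Algebra.Properties.CommutativeSemigroup as CommutativeSemigroupProperties
import Algebra.Properties.Group as GroupProperties
open import Data.Fin.Base as Fin using (Fin; zero; suc; punchOut)
import Data.Fin.Properties as Fin
open import Data.Fin.Permutation using (permutation)
open import Data.Nat.Base as ℕ using (ℕ; zero; suc)
import Data.Nat.Properties as ℕ
open import Data.Nat.Divisibility using (_∣_; ∣m+n∣m⇒∣n; ∣⇒≤; m∣m*n)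
open import Data.Parity.Base as ℙ using (Parity; 0ℙ; 1ℙ)
import Data.Parity.Properties as ℙ
open import Data.Product using (Σ-syntax; ∃; ∃-syntax; _×_; _,_; proj₁; proj₂)
open import Data.Product.Relation.Binary.Pointwise.NonDependent using (×-isEquivalence)
open import Data.Vec.Functional using (Vector; replicate)
open import Algebra.Properties.CommutativeMonoid.Sum ℕ.+-0-commutativeMonoid
  using (sum; sum-remove; sum-cong-≗; sum-replicate-zero; sum-permute; ∑-distrib-+)
open import Function.Base using () renaming (_∘_ to _∘ᶠ_)
open import Function.Bundles using (Inverse)
open import Function.Construct.Composition using (inverse)
open import Relation.Binary.Bundles using (Setoid)
open import Relation.Binary.Definitions using (tri<; tri≈; tri>) renaming (Decidable to Decidable₂)
open import Relation.Binary.PropositionalEquality as ≡ using (_≡_; _≢_)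
import Relation.Binary.Reasoning.Setoid as SetoidReasoning
open import Relation.Nullary.Decidable using (Dec; yes; no; map′; ¬?; _×-dec_; decidable-stable)
open import Relation.Nullary.Negation using (¬_; contradiction)
open import Relation.Unary using (Pred; Decidable; U; _∩_; _≐_; _⟨×⟩_)

private variable
  c ℓ c′ ℓ′ p : Level

-- Finite sets and setoids

-- If `k` were missed, punching it out of the codomain would inject `Fin (suc n)` into a smaller
-- `Fin n`, against the pigeonhole principle.
injection⇒surjective : ∀ {n} (f : Fin n → Fin n) → (∀ {i j} → f i ≡ f j → i ≡ j) →
                       ∀ k → ∃[ i ] f i ≡ k
injection⇒surjective {suc n} f inj k with Fin.any? (λ i → f i Fin.≟ k)
... | yes hit = hit
... | no miss = contradiction
  (λ {i} {j} eq → inj (Fin.punchOut-injective (k≢f i) (k≢f j) eq))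
  (Fin.<⇒notInjective {f = λ i → punchOut (k≢f i)} (ℕ.n<1+n n))
  where
  k≢f : ∀ i → k ≢ f i
  k≢f i k≡fi = miss (i , ≡.sym k≡fi)

-- Members are numbered in increasing order, by induction on `n`. Equality in the subsetoid ignores
-- the proofs of `P`, which need not be unique, so congruence of `to` is shown by cases on the
-- points.
finSubset-finite : ∀ {n} {P : Pred (Fin n) p} → Decidable P →
                   Finite (subsetoid (≡.setoid (Fin n)) P)
finSubset-finite {n = zero} P? = 0 , record
  { to = proj₁ ; from = λ () ; to-cong = λ eq → eq ; from-cong = λ { {()} }
  ; inverse = (λ { {()} }) , λ { {() , _} } }
finSubset-finite {n = suc n} {P} P? with P? zero | finSubset-finite (P? ∘ᶠ suc)
... | yes p₀ | m , P↔m = suc m , record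
  { to = to ; from = from
  ; to-cong = λ {x} {y} → to-cong x y ; from-cong = ≡.cong (proj₁ ∘ᶠ from)
  ; inverse = (λ {i} eq → ≡.trans (to-cong _ (from i) eq) (invˡ i))
            , λ {x} eq → ≡.trans (≡.cong (proj₁ ∘ᶠ from) eq) (invʳ x) }
  where
  module P = Inverse P↔m
  to : ∃ P → Fin (suc m)
  to (zero  , _) = zero
  to (suc i , p) = suc (P.to (i , p))
  from : Fin (suc m) → ∃ P
  from zero    = zero , p₀
  from (suc j) = suc (proj₁ (P.from j)) , proj₂ (P.from j)
  to-cong : ∀ x y → proj₁ x ≡ proj₁ y → to x ≡ to y
  to-cong (zero  , _) (zero  , _) eq = ≡.refl
  to-cong (suc i , _) (suc j , _) eq = ≡.cong suc (P.to-cong (Fin.suc-injective eq))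
  invˡ : ∀ i → to (from i) ≡ i
  invˡ zero    = ≡.refl
  invˡ (suc i) = ≡.cong suc (P.strictlyInverseˡ i)
  invʳ : ∀ x → proj₁ (from (to x)) ≡ proj₁ x
  invʳ (zero  , _) = ≡.refl
  invʳ (suc i , p) = ≡.cong suc (P.strictlyInverseʳ (i , p))
... | no ¬p₀ | m , P↔m = m , record
  { to = to ; from = from
  ; to-cong = λ {x} {y} → to-cong x y ; from-cong = ≡.cong (proj₁ ∘ᶠ from)
  ; inverse = (λ {i} eq → ≡.trans (to-cong _ (from i) eq) (P.strictlyInverseˡ i))
            , λ {x} eq → ≡.trans (≡.cong (proj₁ ∘ᶠ from) eq) (invʳ x) }
  where
  module P = Inverse P↔m
  to : ∃ P → Fin m
  to (zero  , p) = contradiction p ¬p₀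
  to (suc i , p) = P.to (i , p)
  from : Fin m → ∃ P
  from j = suc (proj₁ (P.from j)) , proj₂ (P.from j)
  to-cong : ∀ x y → proj₁ x ≡ proj₁ y → to x ≡ to y
  to-cong (zero  , p) _           eq = contradiction p ¬p₀
  to-cong (suc i , _) (zero  , p) eq = contradiction p ¬p₀
  to-cong (suc i , _) (suc j , _) eq = P.to-cong (Fin.suc-injective eq)
  invʳ : ∀ x → proj₁ (from (to x)) ≡ proj₁ x
  invʳ (zero  , p) = contradiction p ¬p₀
  invʳ (suc i , p) = ≡.cong suc (P.strictlyInverseʳ (i , p))

-- Counting points by means of an involution

sum-zero : ∀ {n} {w : Vector ℕ n} → (∀ i → w i ≡ 0) → sum w ≡ 0
sum-zero {n} w≡0 = ≡.trans (sum-cong-≗ w≡0) (sum-replicate-zero n)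

sum-ones : ∀ n → sum (replicate n 1) ≡ n
sum-ones zero    = ≡.refl
sum-ones (suc n) = ≡.cong suc (sum-ones n)

sum-single : ∀ {n} {w : Vector ℕ n} k → w k ≡ 1 → (∀ i → i ≢ k → w i ≡ 0) → sum w ≡ 1
sum-single {suc n} {w} k wk≡1 w≡0 = ≡.trans (sum-remove w)
  (≡.cong₂ ℕ._+_ wk≡1 (sum-zero λ i → w≡0 _ (Fin.punchInᵢ≢i k i)))

-- Counts each point i as w i + [ i < σ i ] + [ σ i < i ]; σ swaps the last two indicators.
involution-size : ∀ {n} (σ : Fin n → Fin n) → (∀ i → σ (σ i) ≡ i) →
                  (w : Vector ℕ n) → (∀ i → σ i ≡ i → w i ≡ 1) → (∀ i → σ i ≢ i → w i ≡ 0) →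
                  ∃[ s ] n ≡ sum w ℕ.+ (s ℕ.+ s)
involution-size {n} σ σσ w w-fixed w-moved = sum lt , (begin
  n                                                  ≡⟨ sum-ones n ⟨
  sum (replicate n 1)                                ≡⟨ sum-cong-≗ split ⟩
  sum (λ i → w i ℕ.+ (lt i ℕ.+ lt (σ i)))            ≡⟨ ∑-distrib-+ w _ ⟩
  sum w ℕ.+ sum (λ i → lt i ℕ.+ lt (σ i))            ≡⟨ ≡.cong (sum w ℕ.+_) (∑-distrib-+ lt _) ⟩
  sum w ℕ.+ (sum lt ℕ.+ sum (lt ∘ᶠ σ))
    ≡⟨ ≡.cong (λ s → sum w ℕ.+ (sum lt ℕ.+ s)) (sum-permute lt (permutation σ σ σσ σσ)) ⟨
  sum w ℕ.+ (sum lt ℕ.+ sum lt)                      ∎)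
  where
  open ≡.≡-Reasoning
  [_<_] : Fin n → Fin n → ℕ
  [ i < j ] with i Fin.<? j
  ... | yes _ = 1
  ... | no  _ = 0
  lt : Vector ℕ n
  lt i = [ i < σ i ]
  <-yes : ∀ {i j} → i Fin.< j → [ i < j ] ≡ 1
  <-yes {i} {j} i<j with i Fin.<? j
  ... | yes _  = ≡.refl
  ... | no i≮j = contradiction i<j i≮j
  <-no : ∀ {i j} → ¬ i Fin.< j → [ i < j ] ≡ 0
  <-no {i} {j} i≮j with i Fin.<? j
  ... | yes i<j = contradiction i<j i≮j
  ... | no _    = ≡.refl
  split : ∀ i → 1 ≡ w i ℕ.+ (lt i ℕ.+ lt (σ i))
  -- After the rewrite `lt (σ i)` compares `σ i` with `i`, so trichotomy leaves exactly one summand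
  -- equal to 1.
  split i rewrite σσ i with Fin.<-cmp i (σ i)
  ... | tri< i<σi i≢σi σi≮i = ≡.sym
    (≡.cong₂ ℕ._+_ (w-moved i (i≢σi ∘ᶠ ≡.sym)) (≡.cong₂ ℕ._+_ (<-yes i<σi) (<-no σi≮i)))
  ... | tri≈ i≮σi i≡σi σi≮i = ≡.sym
    (≡.cong₂ ℕ._+_ (w-fixed i (≡.sym i≡σi)) (≡.cong₂ ℕ._+_ (<-no i≮σi) (<-no σi≮i)))
  ... | tri> i≮σi i≢σi σi<i = ≡.sym
    (≡.cong₂ ℕ._+_ (w-moved i (i≢σi ∘ᶠ ≡.sym)) (≡.cong₂ ℕ._+_ (<-no i≮σi) (<-yes σi<i)))

-- Decidability, counting and parity in a finite setoid

module FiniteSetoid (S : Setoid c ℓ) {n} (S↔n : HasCardinality S n) where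
  open Setoid S
  open Inverse S↔n using (to; from; to-cong; strictlyInverseˡ; strictlyInverseʳ)

  to-injective : ∀ {x y} → to x ≡ to y → x ≈ y
  to-injective {x} {y} eq = trans (sym (strictlyInverseʳ x))
    (trans (reflexive (≡.cong from eq)) (strictlyInverseʳ y))

  _≈?_ : Decidable₂ _≈_
  x ≈? y = map′ to-injective to-cong (to x Fin.≟ to y)

  injective⇒surjective : (f : Carrier → Carrier) → (∀ {x y} → f x ≈ f y → x ≈ y) →
                         ∀ z → ∃[ x ] f x ≈ z
  injective⇒surjective f inj z with injection⇒surjective (to ∘ᶠ f ∘ᶠ from)
    (λ eq → ≡.trans (≡.sym (strictlyInverseˡ _))
              (≡.trans (to-cong (inj (to-injective eq))) (strictlyInverseˡ _))) (to z)
  ... | i , eq = from i , to-injective eq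

  module _ {P : Pred Carrier p} (resp : ∀ {x y} → x ≈ y → P x → P y) (P? : Decidable P) where

    all? : Dec (∀ x → P x)
    all? = map′ (λ all x → resp (strictlyInverseʳ x) (all (to x))) (_∘ᶠ from) (Fin.all? (P? ∘ᶠ from))

    any? : Dec (∃ P)
    any? = map′ (λ (i , p) → from i , p) (λ (x , p) → to x , resp (sym (strictlyInverseʳ x)) p)
      (Fin.any? (P? ∘ᶠ from))

    ¬∀⇒∃¬ : ¬ (∀ x → P x) → ∃[ x ] ¬ P x
    ¬∀⇒∃¬ ¬all with Fin.¬∀⟶∃¬ n (P ∘ᶠ from) (P? ∘ᶠ from)
      (λ all → ¬all λ x → resp (strictlyInverseʳ x) (all (to x)))
    ... | i , ¬p = from i , ¬p

    subset-finite : Finite (subsetoid S P)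
    subset-finite with finSubset-finite (P? ∘ᶠ from)
    ... | m , P↔m = m , inverse P↔Pfrom P↔m
      where
      P↔Pfrom : Inverse (subsetoid S P) (subsetoid (≡.setoid (Fin n)) (P ∘ᶠ from))
      P↔Pfrom = record
        { to        = λ (x , p) → to x , resp (sym (strictlyInverseʳ x)) p
        ; from      = λ (i , p) → from i , p
        ; to-cong   = to-cong
        ; from-cong = reflexive ∘ᶠ ≡.cong from
        ; inverse   = (λ {(i , _)} eq → ≡.trans (to-cong eq) (strictlyInverseˡ i))
                    , λ {(x , _)} eq → trans (reflexive (≡.cong from eq)) (strictlyInverseʳ x)
        }

  module _ (σ : Carrier → Carrier) (σ-cong : ∀ {x y} → x ≈ y → σ x ≈ σ y)
           (σσ : ∀ x → σ (σ x) ≈ x) where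

    private
      σ′ : Fin n → Fin n
      σ′ = to ∘ᶠ σ ∘ᶠ from

      σ′σ′ : ∀ i → σ′ (σ′ i) ≡ i
      σ′σ′ i = ≡.trans (to-cong (trans (σ-cong (strictlyInverseʳ _)) (σσ _))) (strictlyInverseˡ i)

      σ′-fixed : ∀ {i} → σ′ i ≡ i → σ (from i) ≈ from i
      σ′-fixed {i} eq = to-injective (≡.trans eq (≡.sym (strictlyInverseˡ i)))

    fixedPointFree-involution⇒even : (∀ x → ¬ σ x ≈ x) → 2 ∣ n
    -- Without fixed points the weight 0 is admissible, and only the doubled sum remains.
    fixedPointFree-involution⇒even free with involution-size σ′ σ′σ′ (λ _ → 0)
      (λ i eq → contradiction (σ′-fixed eq) (free (from i))) (λ _ _ → ≡.refl)
    ... | s , n≡ = ≡.subst (2 ∣_) (≡.sym n≡2*s) (m∣m*n s)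
      where
      n≡2*s : n ≡ 2 ℕ.* s
      n≡2*s = ≡.trans n≡ (≡.cong₂ ℕ._+_ (sum-zero {n} λ _ → ≡.refl)
        (≡.cong (s ℕ.+_) (≡.sym (ℕ.+-identityʳ s))))

    uniqueFixedPoint-involution⇒odd : ∀ z → σ z ≈ z → (∀ x → σ x ≈ x → x ≈ z) → ¬ 2 ∣ n
    uniqueFixedPoint-involution⇒odd z σz≈z unique 2∣n = contradiction
      -- From 2 dividing `2 * s + 1` follows that 2 divides 1, hence 2 ≤ 1.
      (∣⇒≤ (∣m+n∣m⇒∣n (≡.subst (2 ∣_) n≡2*s+1 2∣n) (m∣m*n s))) λ { (ℕ.s≤s ()) }
      where
      w : Vector ℕ n
      w i with σ′ i Fin.≟ i
      ... | yes _ = 1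
      ... | no  _ = 0
      w-fixed : ∀ i → σ′ i ≡ i → w i ≡ 1
      w-fixed i eq with σ′ i Fin.≟ i
      ... | yes _ = ≡.refl
      ... | no ¬eq = contradiction eq ¬eq
      w-moved : ∀ i → σ′ i ≢ i → w i ≡ 0
      w-moved i ¬eq with σ′ i Fin.≟ i
      ... | yes eq = contradiction eq ¬eq
      ... | no _ = ≡.refl
      sum-w : sum w ≡ 1
      sum-w = sum-single (to z)
        (w-fixed _ (to-cong (trans (σ-cong (strictlyInverseʳ z)) σz≈z)))
        (λ i i≢z → w-moved i λ eq → i≢z (≡.trans (≡.sym (strictlyInverseˡ i))
          (to-cong (unique _ (σ′-fixed eq)))))
      count : ∃[ s ] n ≡ sum w ℕ.+ (s ℕ.+ s)
      count = involution-size σ′ σ′σ′ w w-fixed w-moved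
      s : ℕ
      s = proj₁ count
      n≡2*s+1 : n ≡ 2 ℕ.* s ℕ.+ 1
      n≡2*s+1 = ≡.trans (proj₂ count) (≡.trans (≡.cong₂ ℕ._+_ sum-w
        (≡.cong (s ℕ.+_) (≡.sym (ℕ.+-identityʳ s)))) (ℕ.+-comm 1 _))

HasCardinality-1< : (S : Setoid c ℓ) {n : ℕ} → HasCardinality S n →
                    ∀ x y → ¬ Setoid._≈_ S x y → 1 ℕ.< n
HasCardinality-1< S {zero} S↔n x y x≉y = contradiction (Inverse.to S↔n x) λ ()
HasCardinality-1< S {suc zero} S↔n x y x≉y =
  contradiction (FiniteSetoid.to-injective S S↔n (Fin1-irrelevant _ _)) x≉y
  where
  Fin1-irrelevant : (i j : Fin 1) → i ≡ j
  Fin1-irrelevant zero zero = ≡.refl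
HasCardinality-1< S {suc (suc n)} S↔n x y x≉y = ℕ.s≤s (ℕ.s≤s ℕ.z≤n)

1<-HasCardinality : (S : Setoid c ℓ) {n : ℕ} → HasCardinality S n → 1 ℕ.< n →
                    ¬ (∀ x y → Setoid._≈_ S x y)
1<-HasCardinality S {suc (suc n)} S↔n (ℕ.s≤s _) all≈ =
  contradiction (≡.trans (≡.sym (strictlyInverseˡ zero))
    (≡.trans (to-cong (all≈ _ _)) (strictlyInverseˡ (suc zero)))) λ ()
  where open Inverse S↔n

-- The skew brace on F × ℤ/2ℤ

module SignedProduct (F : AbelianGroup c ℓ) where
  open AbelianGroup F hiding (_-_)
  open AbelianGroupProperties F
  open CommutativeSemigroupProperties commutativeSemigroup
  open SetoidReasoning setoid

  ± : Parity → Carrier → Carrier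
  ± = signed rawGroup

  ±-cong : ∀ k {f g} → f ≈ g → ± k f ≈ ± k g
  ±-cong 0ℙ f≈g = f≈g
  ±-cong 1ℙ f≈g = ⁻¹-cong f≈g

  ±-congₖ : ∀ {j k} f → j ≡ k → ± j f ≈ ± k f
  ±-congₖ f ≡.refl = refl

  ±-∙ : ∀ k f g → ± k (f ∙ g) ≈ ± k f ∙ ± k g
  ±-∙ 0ℙ f g = refl
  ±-∙ 1ℙ f g = sym (⁻¹-∙-comm f g)

  ±-ε : ∀ k → ± k ε ≈ ε
  ±-ε 0ℙ = refl
  ±-ε 1ℙ = ε⁻¹≈ε

  ±-⁻¹ : ∀ k f → ± k (f ⁻¹) ≈ ± k f ⁻¹
  ±-⁻¹ 0ℙ f = refl
  ±-⁻¹ 1ℙ f = refl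

  -- Together with `±-∙` this makes `±` an action of ℤ/2ℤ by automorphisms, so the additive group is
  -- a semidirect product.
  ±-+ : ∀ j k f → ± (j ℙ.+ k) f ≈ ± j (± k f)
  ±-+ 0ℙ k  f = refl
  ±-+ 1ℙ 0ℙ f = refl
  ±-+ 1ℙ 1ℙ f = sym (⁻¹-involutive f)

  ±-comm : ∀ j k f → ± j (± k f) ≈ ± k (± j f)
  ±-comm j k f = trans (sym (±-+ j k f)) (trans (±-congₖ f (ℙ.+-comm j k)) (±-+ k j f))

  ±-± : ∀ k f → ± k (± k f) ≈ f
  ±-± k f = trans (sym (±-+ k k f)) (±-congₖ f (ℙ.p+p≡0ℙ k))

  private
    module R = RawSkewBrace (F×ℤ/2 rawGroup)

  +-isGroup : IsGroup R._≈_ R._+_ R.0# R.-_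
  +-isGroup = record
    { isMonoid = record
      { isSemigroup = record
        { isMagma = record
          { isEquivalence = ×-isEquivalence isEquivalence ≡.isEquivalence
          ; ∙-cong = λ { {_ , k} (f≈ , ≡.refl) (g≈ , ≡.refl) → ∙-cong f≈ (±-cong k g≈) , ≡.refl }
          }
        ; assoc = λ (f₁ , k₁) (f₂ , k₂) (f₃ , k₃) →
            (begin
              (f₁ ∙ ± k₁ f₂) ∙ ± (k₁ ℙ.+ k₂) f₃  ≈⟨ ∙-congˡ (±-+ k₁ k₂ f₃) ⟩
              (f₁ ∙ ± k₁ f₂) ∙ ± k₁ (± k₂ f₃)    ≈⟨ assoc _ _ _ ⟩
              f₁ ∙ (± k₁ f₂ ∙ ± k₁ (± k₂ f₃))    ≈⟨ ∙-congˡ (±-∙ k₁ _ _) ⟨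
              f₁ ∙ ± k₁ (f₂ ∙ ± k₂ f₃)           ∎)
            , ℙ.+-assoc k₁ k₂ k₃
        }
      ; identity = (λ (f , k) → identityˡ f , ≡.refl)
                 , (λ (f , k) → trans (∙-congˡ (±-ε k)) (identityʳ f) , ℙ.+-identityʳ k)
      }
    ; inverse = (λ (f , k) → trans (∙-congʳ (sym (±-⁻¹ k f)))
                    (trans (sym (±-∙ k _ _)) (trans (±-cong k (inverseˡ f)) (±-ε k))) , ℙ.p+p≡0ℙ k)
              , (λ (f , k) → trans (∙-congˡ (trans (±-⁻¹ k _) (⁻¹-cong (±-± k f)))) (inverseʳ f)
                    , ℙ.p+p≡0ℙ k)
    ; ⁻¹-cong = λ { {_ , k} (f≈ , ≡.refl) → ⁻¹-cong (±-cong k f≈) , ≡.refl }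
    }

  ∘-isGroup : IsGroup R._≈_ R._∘_ R.1# R._⁻¹
  ∘-isGroup = record
    { isMonoid = record
      { isSemigroup = record
        { isMagma = record
          { isEquivalence = ×-isEquivalence isEquivalence ≡.isEquivalence
          ; ∙-cong = λ { {_ , j} {_} {_ , k} (f≈ , ≡.refl) (g≈ , ≡.refl) →
              ∙-cong (±-cong k f≈) (±-cong j g≈) , ≡.refl }
          }
        -- Either bracketing gives each `f` the sign of the sum of the other two parities.
        ; assoc = λ (f₁ , k₁) (f₂ , k₂) (f₃ , k₃) →
            (begin
              ± k₃ (± k₂ f₁ ∙ ± k₁ f₂) ∙ ± (k₁ ℙ.+ k₂) f₃
                ≈⟨ ∙-cong (±-∙ k₃ _ _) (±-+ k₁ k₂ f₃) ⟩
              (± k₃ (± k₂ f₁) ∙ ± k₃ (± k₁ f₂)) ∙ ± k₁ (± k₂ f₃)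
                ≈⟨ assoc _ _ _ ⟩
              ± k₃ (± k₂ f₁) ∙ (± k₃ (± k₁ f₂) ∙ ± k₁ (± k₂ f₃))
                ≈⟨ ∙-cong (trans (±-comm k₃ k₂ f₁) (sym (±-+ k₂ k₃ f₁)))
                     (∙-congʳ (±-comm k₃ k₁ f₂)) ⟩
              ± (k₂ ℙ.+ k₃) f₁ ∙ (± k₁ (± k₃ f₂) ∙ ± k₁ (± k₂ f₃))
                ≈⟨ ∙-congˡ (±-∙ k₁ _ _) ⟨
              ± (k₂ ℙ.+ k₃) f₁ ∙ ± k₁ (± k₃ f₂ ∙ ± k₂ f₃) ∎)
            , ℙ.+-assoc k₁ k₂ k₃
        }
      ; identity = (λ (f , k) → trans (∙-congʳ (±-ε k)) (identityˡ f) , ≡.refl)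
                 , (λ (f , k) → trans (∙-congˡ (±-ε k)) (identityʳ f) , ℙ.+-identityʳ k)
      }
    ; inverse = (λ (f , k) → trans (sym (±-∙ k _ _)) (trans (±-cong k (inverseˡ f)) (±-ε k))
                    , ℙ.p+p≡0ℙ k)
              , (λ (f , k) → trans (sym (±-∙ k _ _)) (trans (±-cong k (inverseʳ f)) (±-ε k))
                    , ℙ.p+p≡0ℙ k)
    ; ⁻¹-cong = λ { (f≈ , ≡.refl) → ⁻¹-cong f≈ , ≡.refl }
    }

  F×ℤ/2-isSkewBrace : IsSkewBrace (F×ℤ/2 rawGroup)
  F×ℤ/2-isSkewBrace = record
    { +-isGroup = +-isGroup
    ; ∘-isGroup = ∘-isGroup
    ; brace = λ (f₁ , k₁) (f₂ , k₂) (f₃ , k₃) → brace₁ f₁ k₁ f₂ k₂ f₃ k₃ , brace₂ k₁ k₂ k₃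
    }
    where
    brace₂ : ∀ k₁ k₂ k₃ → k₁ ℙ.+ (k₂ ℙ.+ k₃) ≡ k₁ ℙ.+ k₂ ℙ.+ k₁ ℙ.+ (k₁ ℙ.+ k₃)
    brace₂ 0ℙ k₂ k₃ = ≡.cong (ℙ._+ k₃) (≡.sym (ℙ.+-identityʳ k₂))
    brace₂ 1ℙ 0ℙ k₃ = ≡.refl
    brace₂ 1ℙ 1ℙ k₃ = ≡.refl
    k+j+k≡j : ∀ k j → k ℙ.+ j ℙ.+ k ≡ j
    k+j+k≡j 0ℙ j  = ℙ.+-identityʳ j
    k+j+k≡j 1ℙ 0ℙ = ≡.refl
    k+j+k≡j 1ℙ 1ℙ = ≡.refl
    -- The two occurrences of `k₁` cancel modulo 2, so the inverted middle term is `± k₂ f₁ ⁻¹`, and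
    -- commutativity cancels it against the leading `± k₂ f₁`.
    brace₁ : ∀ f₁ k₁ f₂ k₂ f₃ k₃ →
      ± (k₂ ℙ.+ k₃) f₁ ∙ ± k₁ (f₂ ∙ ± k₂ f₃) ≈
      ± k₂ f₁ ∙ ± k₁ f₂ ∙ ± (k₁ ℙ.+ k₂) (± k₁ f₁ ⁻¹) ∙
        ± (k₁ ℙ.+ k₂ ℙ.+ k₁) (± k₃ f₁ ∙ ± k₁ f₃)
    brace₁ f₁ k₁ f₂ k₂ f₃ k₃ = begin
      ± (k₂ ℙ.+ k₃) f₁ ∙ ± k₁ (f₂ ∙ ± k₂ f₃)
        ≈⟨ ∙-cong (±-+ k₂ k₃ f₁) (trans (±-∙ k₁ _ _) (∙-congˡ (±-comm k₁ k₂ f₃))) ⟩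
      ± k₂ (± k₃ f₁) ∙ (± k₁ f₂ ∙ ± k₂ (± k₁ f₃))
        ≈⟨ x∙yz≈y∙xz _ _ _ ⟩
      ± k₁ f₂ ∙ (± k₂ (± k₃ f₁) ∙ ± k₂ (± k₁ f₃))
        ≈⟨ ∙-cong (xyx⁻¹≈y _ _) (±-∙ k₂ _ _) ⟨
      ± k₂ f₁ ∙ ± k₁ f₂ ∙ ± k₂ f₁ ⁻¹ ∙ ± k₂ (± k₃ f₁ ∙ ± k₁ f₃)
        ≈⟨ ∙-cong (∙-congˡ cancel) (±-congₖ _ (k+j+k≡j k₁ k₂)) ⟨
      ± k₂ f₁ ∙ ± k₁ f₂ ∙ ± (k₁ ℙ.+ k₂) (± k₁ f₁ ⁻¹) ∙
        ± (k₁ ℙ.+ k₂ ℙ.+ k₁) (± k₃ f₁ ∙ ± k₁ f₃)   ∎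
      where
      cancel : ± (k₁ ℙ.+ k₂) (± k₁ f₁ ⁻¹) ≈ ± k₂ f₁ ⁻¹
      cancel = begin
        ± (k₁ ℙ.+ k₂) (± k₁ f₁ ⁻¹)  ≈⟨ ±-⁻¹ (k₁ ℙ.+ k₂) _ ⟩
        ± (k₁ ℙ.+ k₂) (± k₁ f₁) ⁻¹  ≈⟨ ⁻¹-cong (±-+ (k₁ ℙ.+ k₂) k₁ f₁) ⟨
        ± (k₁ ℙ.+ k₂ ℙ.+ k₁) f₁ ⁻¹  ≈⟨ ⁻¹-cong (±-congₖ f₁ (k+j+k≡j k₁ k₂)) ⟩
        ± k₂ f₁ ⁻¹                  ∎

  signedProduct : SkewBrace c ℓ
  signedProduct = mkSkewBrace (F×ℤ/2 rawGroup) F×ℤ/2-isSkewBrace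

  -- Fix, kernel and orbits of the signed product

  open SkewBrace signedProduct using (lam; Fix; Ker-lam; Orbit; NontrivialOrbit; Λ)
    renaming (_≈_ to _≋_; setoid to ≋-setoid; refl to ≋-refl; sym to ≋-sym; trans to ≋-trans)

  -- For `k = 0ℙ` the first two factors cancel; for `k = 1ℙ` they form the inverse square of
  -- `± j g`. Thus `lam` is the identity on one layer and a translation on the other.
  lam-formula : ∀ g j f k → lam (g , j) (f , k) ≋ (± j g ⁻¹ ∙ ± k (± j g) ∙ f , k)
  lam-formula g j f k = (begin
    ± j g ⁻¹ ∙ ± j (± k g ∙ ± j f)          ≈⟨ ∙-congˡ (±-∙ j _ _) ⟩
    ± j g ⁻¹ ∙ (± j (± k g) ∙ ± j (± j f))  ≈⟨ ∙-congˡ (∙-cong (±-comm j k g) (±-± j f)) ⟩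
    ± j g ⁻¹ ∙ (± k (± j g) ∙ f)            ≈⟨ assoc _ _ _ ⟨
    ± j g ⁻¹ ∙ ± k (± j g) ∙ f              ∎)
    , ≡.trans (≡.sym (ℙ.+-assoc j j k)) (≡.cong (ℙ._+ k) (ℙ.p+p≡0ℙ j))

  fixed-0ℙ : ∀ f → Fix (f , 0ℙ)
  fixed-0ℙ f (g , j) = ≋-trans (lam-formula g j f 0ℙ)
    (trans (∙-congʳ (inverseˡ _)) (identityˡ f) , ≡.refl)

  -- A translation with a fixed point is by `ε`; removing the inverse and the sign from the
  -- translating element leaves `g ∙ g`.
  lam≋⇒square≈ε : ∀ {g j f} → lam (g , j) (f , 1ℙ) ≋ (f , 1ℙ) → g ∙ g ≈ ε
  lam≋⇒square≈ε {g} {j} {f} fixed = begin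
    g ∙ g                        ≈⟨ ±-± j _ ⟨
    ± j (± j (g ∙ g))            ≈⟨ ±-cong j (±-∙ j g g) ⟩
    ± j (± j g ∙ ± j g)          ≈⟨ ±-cong j (⁻¹-involutive _) ⟨
    ± j ((± j g ∙ ± j g) ⁻¹ ⁻¹)  ≈⟨ ±-cong j (⁻¹-cong inv≈ε) ⟩
    ± j (ε ⁻¹)                   ≈⟨ ±-cong j ε⁻¹≈ε ⟩
    ± j ε                        ≈⟨ ±-ε j ⟩
    ε                            ∎
    where
    inv≈ε : (± j g ∙ ± j g) ⁻¹ ≈ ε
    inv≈ε = trans (sym (⁻¹-∙-comm _ _))
      (identityˡ-unique _ f (proj₁ (≋-trans (≋-sym (lam-formula g j f 1ℙ)) fixed)))

  module _ {n} (F↔n : HasCardinality setoid n) (odd : ¬ 2 ∣ n) where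
    open FiniteSetoid setoid F↔n

    -- An element `g` of order 2 would make `_∙ g` a fixed-point-free involution, and the order
    -- would be even.
    square≈ε⇒≈ε : ∀ {g} → g ∙ g ≈ ε → g ≈ ε
    square≈ε⇒≈ε {g} gg≈ε with g ≈? ε
    ... | yes g≈ε = g≈ε
    ... | no  g≉ε = contradiction (fixedPointFree-involution⇒even (_∙ g) ∙-congʳ
      (λ x → trans (assoc x g g) (trans (∙-congˡ gg≈ε) (identityʳ x)))
      (λ x xg≈x → g≉ε (identityʳ-unique x g xg≈x))) odd

    -- In an abelian group squaring is an endomorphism, so a trivial kernel suffices.
    square-injective : ∀ {x y} → x ∙ x ≈ y ∙ y → x ≈ y
    square-injective {x} {y} xx≈yy = x∙y⁻¹≈ε⇒x≈y x y (square≈ε⇒≈ε (begin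
      (x ∙ y ⁻¹) ∙ (x ∙ y ⁻¹)  ≈⟨ interchange _ _ _ _ ⟩
      (x ∙ x) ∙ (y ⁻¹ ∙ y ⁻¹)  ≈⟨ ∙-cong xx≈yy (⁻¹-∙-comm y y) ⟩
      (y ∙ y) ∙ (y ∙ y) ⁻¹     ≈⟨ inverseʳ _ ⟩
      ε                        ∎))

    orbit-1ℙ : ∀ f f′ → Orbit (f , 1ℙ) (f′ , 1ℙ)
    orbit-1ℙ f f′ with injective⇒surjective (λ x → x ∙ x) square-injective (f′ ∙ f ⁻¹)
    -- `h` is half of the difference from `f` to `f′`; acting by the inverse of `h` in layer `0ℙ`
    -- translates by `h ∙ h`.
    ... | h , hh≈ = (h ⁻¹ , 0ℙ) , ≋-trans (lam-formula (h ⁻¹) 0ℙ f 1ℙ) ((begin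
      h ⁻¹ ⁻¹ ∙ h ⁻¹ ⁻¹ ∙ f  ≈⟨ ∙-congʳ (∙-cong (⁻¹-involutive h) (⁻¹-involutive h)) ⟩
      h ∙ h ∙ f              ≈⟨ ∙-congʳ hh≈ ⟩
      f′ ∙ f ⁻¹ ∙ f          ≈⟨ //-rightDividesˡ f f′ ⟩
      f′                     ∎) , ≡.refl)

    module _ {x} (x≉ε : ¬ x ≈ ε) where

      signedProduct-Fix : Fix ≐ (U ⟨×⟩ (_≡ 0ℙ))
      signedProduct-Fix = to-0ℙ , λ { {f , _} (_ , ≡.refl) → fixed-0ℙ f }
        where
        to-0ℙ : ∀ {y} → Fix y → (U ⟨×⟩ (_≡ 0ℙ)) y
        to-0ℙ {f , 0ℙ} _     = _ , ≡.refl
        to-0ℙ {f , 1ℙ} fixed = contradiction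
          -- Being fixed by `(x , 0ℙ)` alone would already force `x` to be `ε`.
          (square≈ε⇒≈ε (lam≋⇒square≈ε {j = 0ℙ} (fixed (x , 0ℙ)))) x≉ε

      signedProduct-Ker : Ker-lam ≐ ((_≈ ε) ⟨×⟩ U)
      signedProduct-Ker =
          -- One point of layer `1ℙ` detects the kernel, since every `(g , j)` translates that layer
          -- by a square up to sign.
          (λ {(g , j)} ker → square≈ε⇒≈ε (lam≋⇒square≈ε {j = j} (ker (ε , 1ℙ))) , _)
        , λ { {g , j} (g≈ε , _) (f , k) →
              ≋-trans (lam-formula g j f k) (acts-trivially g≈ε j f k , ≡.refl) }
        where
        acts-trivially : ∀ {g} → g ≈ ε → ∀ j f k → ± j g ⁻¹ ∙ ± k (± j g) ∙ f ≈ f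
        acts-trivially {g} g≈ε j f k = begin
          ± j g ⁻¹ ∙ ± k (± j g) ∙ f  ≈⟨ ∙-congʳ (∙-cong (⁻¹-cong jg≈ε) (±-cong k jg≈ε)) ⟩
          ε ⁻¹ ∙ ± k ε ∙ f            ≈⟨ ∙-congʳ (∙-cong ε⁻¹≈ε (±-ε k)) ⟩
          ε ∙ ε ∙ f                   ≈⟨ trans (∙-congʳ (identityˡ ε)) (identityˡ f) ⟩
          f                           ∎
          where
          jg≈ε : ± j g ≈ ε
          jg≈ε = trans (±-cong j g≈ε) (±-ε j)

      signedProduct-Λ : HasExactlyOneVertex Λ
      signedProduct-Λ = vertex , unique
        where
        orbit-parity : ∀ {f k g j} → Orbit (f , k) (g , j) → k ≡ j
        orbit-parity {f} {k} ((h , i) , eq) = proj₂ (≋-trans (≋-sym (lam-formula h i f k)) eq)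
        -- The orbit is the whole layer `1ℙ`, so its points are numbered by the first coordinate.
        orbit↔n : HasCardinality (subsetoid ≋-setoid (Orbit (ε , 1ℙ))) n
        orbit↔n = record
          { to        = λ ((f , _) , _) → to f
          ; from      = λ i → (from i , 1ℙ) , orbit-1ℙ ε (from i)
          ; to-cong   = λ (f≈g , _) → to-cong f≈g
          ; from-cong = λ i≡j → from-cong i≡j , ≡.refl
          ; inverse   = (λ (f≈ , _) → inverseˡ′ f≈)
                      , λ { {(f , k) , f∈} eq → inverseʳ′ eq , orbit-parity f∈ }
          }
          where open Inverse F↔n renaming (inverseˡ to inverseˡ′; inverseʳ to inverseʳ′)
        open NontrivialOrbit
        vertex : NontrivialOrbit
        vertex = record
          { elements = Orbit (ε , 1ℙ)
          ; isOrbit  = (ε , 1ℙ) , (λ o → o) , (λ o → o)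
          ; size     = n
          ; hasSize  = orbit↔n
          ; 1<size   = HasCardinality-1< setoid F↔n x ε x≉ε
          }
        unique : ∀ w → elements w ≐ Orbit (ε , 1ℙ)
        unique w with isOrbit w
        -- Points of layer `0ℙ` are fixed, so this orbit would be a single point, against `1<size`.
        ... | (f , 0ℙ) , w⊆ , _ = contradiction
          (λ (_ , a) (_ , b) → ≋-trans (≋-sym (constant (w⊆ a))) (constant (w⊆ b)))
          (1<-HasCardinality (subsetoid ≋-setoid (elements w)) (hasSize w) (1<size w))
          where
          constant : ∀ {z} → Orbit (f , 0ℙ) z → (f , 0ℙ) ≋ z
          constant (g , eq) = ≋-trans (≋-sym (fixed-0ℙ f g)) eq
        ... | (f , 1ℙ) , w⊆ , ⊆w = (λ {z} z∈w → orbit⊆ ε (w⊆ z∈w)) , λ {z} z∈ → ⊆w (orbit⊆ f z∈)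
          where
          orbit⊆ : ∀ {g} f {z} → Orbit (g , 1ℙ) z → Orbit (f , 1ℙ) z
          orbit⊆ f {h , k} z∈ with ≡.refl ← orbit-parity z∈ = orbit-1ℙ f h

-- Group isomorphisms

module _ (G : Group c ℓ) (H : Group c′ ℓ′) where
  private
    module G where
      open Group G public
      open GroupProperties G public
    module H where
      open Group H public
      open GroupProperties H public
  open GroupMorphisms G.rawGroup H.rawGroup

  ∙-homo⇒isGroupHomomorphism : (f : G.Carrier → H.Carrier) → (∀ {x y} → x G.≈ y → f x H.≈ f y) →
                               (∀ x y → f (x G.∙ y) H.≈ f x H.∙ f y) → IsGroupHomomorphism f
  ∙-homo⇒isGroupHomomorphism f f-cong f-∙ = record
    { isMonoidHomomorphism = record
      { isMagmaHomomorphism = record { isRelHomomorphism = record { cong = f-cong } ; homo = f-∙ }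
      ; ε-homo = f-ε
      }
    ; ⁻¹-homo = λ x → H.inverseˡ-unique _ _
        (H.trans (H.sym (f-∙ _ x)) (H.trans (f-cong (G.inverseˡ x)) f-ε))
    }
    where
    f-ε : f G.ε H.≈ H.ε
    f-ε = H.identityʳ-unique _ _ (H.trans (H.sym (f-∙ _ _)) (f-cong (G.identityˡ G.ε)))

  -- Applying the injective `h` turns each law for `f` into a law for `h`. The isomorphism can thus
  -- be checked on the map out of the product, where the cases are explicit.
  section-isGroupIsomorphism : (h : H.Carrier → G.Carrier) → (∀ {x y} → x H.≈ y → h x G.≈ h y) →
                               (∀ x y → h (x H.∙ y) G.≈ h x G.∙ h y) →
                               (∀ {x y} → h x G.≈ h y → x H.≈ y) →
                               (f : G.Carrier → H.Carrier) → (∀ x → h (f x) G.≈ x) →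
                               IsGroupIsomorphism f
  section-isGroupIsomorphism h h-cong h-∙ h-inj f hf≈ = record
    { isGroupMonomorphism = record
      { isGroupHomomorphism = ∙-homo⇒isGroupHomomorphism f
          (λ x≈y → h-inj (G.trans (hf≈ _) (G.trans x≈y (G.sym (hf≈ _)))))
          (λ x y → h-inj (G.trans (hf≈ _)
            (G.sym (G.trans (h-∙ _ _) (G.∙-cong (hf≈ x) (hf≈ y))))))
      ; injective = λ fx≈fy → G.trans (G.sym (hf≈ _)) (G.trans (h-cong fx≈fy) (hf≈ _))
      }
    ; surjective = λ y → h y , λ z≈hy → h-inj (G.trans (hf≈ _) z≈hy)
    }

-- Skew braces with one nontrivial orbit

module SkewBraceProperties (A : SkewBrace c ℓ) where
  open SkewBrace A public
  module + where
    open Group +-group public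
    open GroupProperties +-group public
  module ∘ where
    open Group ∘-group public
    open GroupProperties ∘-group public
  open SetoidReasoning setoid

  lam-cong : ∀ {x x′ y y′} → x ≈ x′ → y ≈ y′ → lam x y ≈ lam x′ y′
  lam-cong x≈x′ y≈y′ = +.∙-cong (+.⁻¹-cong x≈x′) (∘.∙-cong x≈x′ y≈y′)

  ∘-lam : ∀ x y → x ∘ y ≈ x + lam x y
  ∘-lam x y = sym (+.\\-leftDividesˡ x (x ∘ y))

  lam-+ : ∀ x y z → lam x (y + z) ≈ lam x y + lam x z
  lam-+ x y z = begin
    - x + x ∘ (y + z)             ≈⟨ +.∙-congˡ (brace x y z) ⟩
    - x + (x ∘ y + - x + x ∘ z)   ≈⟨ +.∙-congˡ (+.assoc _ _ _) ⟩
    - x + (x ∘ y + (- x + x ∘ z)) ≈⟨ +.assoc _ _ _ ⟨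
    lam x y + lam x z             ∎

  lam-0 : ∀ x → lam x 0# ≈ 0#
  lam-0 x = +.identityʳ-unique _ _
    (trans (sym (lam-+ x 0# 0#)) (lam-cong refl (+.identityˡ 0#)))

  lam-neg : ∀ x y → lam x (- y) ≈ - lam x y
  lam-neg x y = +.inverseʳ-unique _ _
    (trans (sym (lam-+ x y (- y))) (trans (lam-cong refl (+.inverseʳ y)) (lam-0 x)))

  1≈0 : 1# ≈ 0#
  1≈0 = begin
    1#             ≈⟨ +.identityʳ 1# ⟨
    1# + 0#        ≈⟨ +.∙-congˡ (lam-0 1#) ⟨
    1# + lam 1# 0# ≈⟨ ∘-lam 1# 0# ⟨
    1# ∘ 0#        ≈⟨ ∘.identityˡ 0# ⟩
    0#             ∎

  -- Expanding both products by `∘-lam` cancels `x`; what remains is `lam x` applied to a sum, by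
  -- additivity.
  lam-∘ : ∀ x y z → lam (x ∘ y) z ≈ lam x (lam y z)
  lam-∘ x y z = begin
    - (x ∘ y) + x ∘ y ∘ z                          ≈⟨ +.∙-congˡ (∘.assoc x y z) ⟩
    - (x ∘ y) + x ∘ (y ∘ z)                        ≈⟨ +.∙-cong (+.⁻¹-cong (∘-lam x y)) (∘-lam x _) ⟩
    - (x + lam x y) + (x + lam x (y ∘ z))          ≈⟨ +.∙-congʳ (+.⁻¹-anti-homo-∙ x _) ⟩
    - lam x y + - x + (x + lam x (y ∘ z))          ≈⟨ +.assoc _ _ _ ⟩
    - lam x y + (- x + (x + lam x (y ∘ z)))        ≈⟨ +.∙-congˡ (+.\\-leftDividesʳ x _) ⟩
    - lam x y + lam x (y ∘ z)                      ≈⟨ +.∙-congʳ (lam-neg x y) ⟨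
    lam x (- y) + lam x (y ∘ z)                    ≈⟨ lam-+ x (- y) (y ∘ z) ⟨
    lam x (lam y z)                                ∎

  lam-1 : ∀ y → lam 1# y ≈ y
  lam-1 y = begin
    - 1# + 1# ∘ y  ≈⟨ +.∙-cong (+.⁻¹-cong 1≈0) (∘.identityˡ y) ⟩
    - 0# + y       ≈⟨ +.∙-congʳ +.ε⁻¹≈ε ⟩
    0# + y         ≈⟨ +.identityˡ y ⟩
    y              ∎

  lam-inverseˡ : ∀ x y → lam (x ⁻¹) (lam x y) ≈ y
  lam-inverseˡ x y = trans (sym (lam-∘ _ x y)) (trans (lam-cong (∘.inverseˡ x) refl) (lam-1 y))

  lam-inverseʳ : ∀ x y → lam x (lam (x ⁻¹) y) ≈ y
  lam-inverseʳ x y = trans (sym (lam-∘ x _ y)) (trans (lam-cong (∘.inverseʳ x) refl) (lam-1 y))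

  Fix-resp : ∀ {y z} → y ≈ z → Fix y → Fix z
  Fix-resp y≈z fy x = trans (lam-cong refl (sym y≈z)) (trans (fy x) y≈z)

  Fix-0 : Fix 0#
  Fix-0 = lam-0

  Fix-+ : ∀ {y z} → Fix y → Fix z → Fix (y + z)
  Fix-+ fy fz x = trans (lam-+ x _ _) (+.∙-cong (fy x) (fz x))

  Fix-neg : ∀ {y} → Fix y → Fix (- y)
  Fix-neg fy x = trans (lam-neg x _) (+.⁻¹-cong (fy x))

  Fix-+ˡ : ∀ {y z} → Fix z → Fix (y + z) → Fix y
  Fix-+ˡ {y} {z} fz fyz = Fix-resp (+.//-rightDividesʳ z y) (Fix-+ fyz (Fix-neg fz))

  -- A fixed `lam x y` is in particular fixed by `x ⁻¹`, which sends it back to `y`.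
  Fix-lam : ∀ {x y} → Fix (lam x y) → Fix y
  Fix-lam {x} {y} f = Fix-resp (trans (sym (f (x ⁻¹))) (lam-inverseˡ x y)) f

  Fix-∘ : ∀ x {y} → Fix y → x ∘ y ≈ x + y
  Fix-∘ x {y} fy = trans (∘-lam x y) (+.∙-congˡ (fy x))

  Ker-∘ : ∀ {x} y → Ker-lam x → x ∘ y ≈ x + y
  Ker-∘ {x} y kx = trans (∘-lam x y) (+.∙-congˡ (kx y))

  Ker-resp : ∀ {x y} → x ≈ y → Ker-lam x → Ker-lam y
  Ker-resp x≈y kx z = trans (lam-cong (sym x≈y) refl) (kx z)

  Ker-comp : ∀ {x y} → Ker-lam x → Ker-lam y → Ker-lam (x ∘ y)
  Ker-comp {x} {y} kx ky z = trans (lam-∘ x y z) (trans (kx _) (ky z))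

  Ker-conj : ∀ x {k} → Ker-lam k → Ker-lam (x ∘ k ∘ x ⁻¹)
  Ker-conj x {k} kk z = begin
    lam (x ∘ k ∘ x ⁻¹) z         ≈⟨ lam-∘ _ _ z ⟩
    lam (x ∘ k) (lam (x ⁻¹) z)   ≈⟨ lam-∘ x k _ ⟩
    lam x (lam k (lam (x ⁻¹) z)) ≈⟨ lam-cong refl (kk _) ⟩
    lam x (lam (x ⁻¹) z)         ≈⟨ lam-inverseʳ x z ⟩
    z                            ∎

  Orbit-refl : ∀ {y} → Orbit y y
  Orbit-refl = 1# , lam-1 _

  Orbit-resp : ∀ {y z w} → z ≈ w → Orbit y z → Orbit y w
  Orbit-resp z≈w (x , eq) = x , trans eq z≈w

  fixSkewBrace-isTrivial : SkewBrace.IsTrivial (fixSkewBrace A)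
  fixSkewBrace-isTrivial (x , _) (y , fy) = sym (Fix-∘ x fy)

-- Orbits and stabilizers in a finite skew brace

module FiniteSkewBrace (A : SkewBrace c ℓ) {n} (A↔n : HasCardinality (SkewBrace.setoid A) n) where
  open SkewBraceProperties A
  open FiniteSetoid setoid A↔n
  open Inverse A↔n using (to; from; to-cong; strictlyInverseʳ)
  open SetoidReasoning setoid
  open NontrivialOrbit

  lam≈-resp : ∀ {y z x x′} → x ≈ x′ → lam x y ≈ z → lam x′ y ≈ z
  lam≈-resp x≈x′ eq = trans (lam-cong (sym x≈x′) refl) eq

  Fix? : ∀ y → Dec (Fix y)
  Fix? y = all? lam≈-resp (λ x → lam x y ≈? y)

  Orbit? : ∀ y z → Dec (Orbit y z)
  Orbit? y z = any? lam≈-resp (λ x → lam x y ≈? z)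

  orbitOf : ∀ {y} → ¬ Fix y → NontrivialOrbit
  orbitOf {y} ¬fy with subset-finite Orbit-resp (Orbit? y)
                     | ¬∀⇒∃¬ lam≈-resp (λ x → lam x y ≈? y) ¬fy
  ... | size , hasSize | x , moved = record
    { elements = Orbit y
    ; isOrbit  = y , (λ o → o) , (λ o → o)
    ; size     = size
    ; hasSize  = hasSize
    ; 1<size   = HasCardinality-1< (subsetoid setoid (Orbit y)) hasSize
                   (lam x y , x , refl) (y , Orbit-refl) moved
    }

  -- The orbit of a fixed point is a singleton, so any point generating the vertex is moved.
  oneOrbit⇒moved : HasExactlyOneVertex Λ → ∃[ y ] ¬ Fix y
  oneOrbit⇒moved (v , _) with isOrbit v
  ... | y , v⊆ , _ = y , λ fy →
    1<-HasCardinality (subsetoid setoid (elements v)) (hasSize v) (1<size v)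
    λ (_ , a) (_ , b) → trans (sym (constant fy (v⊆ a))) (constant fy (v⊆ b))
    where
    constant : Fix y → ∀ {z} → Orbit y z → y ≈ z
    constant fy (x , eq) = trans (sym (fy x)) eq

  -- The orbits of `y` and `z` are both vertices, hence both equal `v`, and `z` lies in its own
  -- orbit.
  oneOrbit⇒transitive : HasExactlyOneVertex Λ → ∀ {y z} → ¬ Fix y → ¬ Fix z → Orbit y z
  oneOrbit⇒transitive (v , unique) ¬fy ¬fz =
    proj₂ (unique (orbitOf ¬fy)) (proj₁ (unique (orbitOf ¬fz)) Orbit-refl)

  module _ (transitive : ∀ {y z} → ¬ Fix y → ¬ Fix z → Orbit y z) where

    -- Otherwise x ↦ λ_x(y) would be injective, hence surjective, and y would be in the orbit of 0.
    nontrivialStabilizer : ∀ {y} → ¬ Fix y → ∃[ t ] ¬ t ≈ 1# × lam t y ≈ y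
    nontrivialStabilizer {y} ¬fy
      with any? (λ x≈x′ (x≉1 , eq) → (λ x′≈1 → x≉1 (trans x≈x′ x′≈1)) , lam≈-resp x≈x′ eq)
                (λ x → ¬? (x ≈? 1#) ×-dec lam x y ≈? y)
    ... | yes found = found
    ... | no  none  = contradiction
      (Fix-lam (Fix-resp (sym (proj₂ hit)) Fix-0)) ¬fy
      where
      stabilizer-trivial : ∀ {x} → lam x y ≈ y → x ≈ 1#
      stabilizer-trivial {x} eq = decidable-stable (x ≈? 1#) λ x≉1 → none (x , x≉1 , eq)
      hit : ∃[ x ] lam x y ≈ 0#
      hit = injective⇒surjective (λ x → lam x y) (λ {x} {x′} eq → begin
        x                   ≈⟨ ∘.\\-leftDividesˡ x′ x ⟨
        -- Since `x` and `x′` send `y` to the same point, `x′ ⁻¹ ∘ x` stabilizes `y`.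
        x′ ∘ (x′ ⁻¹ ∘ x)    ≈⟨ ∘.∙-congˡ (stabilizer-trivial (trans (lam-∘ _ x y)
                                 (trans (lam-cong refl eq) (lam-inverseˡ x′ y)))) ⟩
        x′ ∘ 1#             ≈⟨ ∘.identityʳ x′ ⟩
        x′                  ∎) 0#

    -- Let r z be a transporter of y to z. The elements r z and r z ∘ t are pairwise distinct, so if
    -- a lay outside Fix ∪ (y + Fix) then the injection sending x ∉ Fix to r x and x ∈ Fix to
    -- r (y + x) ∘ t would miss r a ∘ t.
    movedCoset : ∀ {y} → ¬ Fix y → ∀ {a} → ¬ Fix a → Fix (- y + a)
    movedCoset {y} ¬fy {a} ¬fa with nontrivialStabilizer ¬fy
    ... | t , t≉1 , ty≈y = decidable-stable (Fix? (- y + a)) λ ¬f-y+a → missed ¬f-y+a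
            (injective⇒surjective h (λ {x} {x′} → h-injective x x′) (ι a 1ℙ))
      where
      pick : ∀ i → Dec (Fix (from i)) → Carrier
      pick i (yes _)  = 0#
      pick i (no ¬fz) = proj₁ (transitive ¬fy ¬fz)

      pick-lam : ∀ i d → ¬ Fix (from i) → lam (pick i d) y ≈ from i
      pick-lam i (yes fz) ¬fz = contradiction fz ¬fz
      pick-lam i (no ¬fz) _   = proj₂ (transitive ¬fy ¬fz)

      -- r depends on z only through to z, which makes it respect ≈.
      r : Carrier → Carrier
      r z = pick (to z) (Fix? (from (to z)))

      r-cong : ∀ {z w} → z ≈ w → r z ≈ r w
      r-cong z≈w = +.reflexive (≡.cong (λ i → pick i (Fix? (from i))) (to-cong z≈w))

      r-lam : ∀ {z} → ¬ Fix z → lam (r z) y ≈ z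
      r-lam {z} ¬fz = trans (pick-lam (to z) (Fix? _) λ f → ¬fz (Fix-resp (strictlyInverseʳ z) f))
        (strictlyInverseʳ z)

      ι : Carrier → Parity → Carrier
      ι z 0ℙ = r z
      ι z 1ℙ = r z ∘ t

      ι-lam : ∀ {z} k → ¬ Fix z → lam (ι z k) y ≈ z
      ι-lam     0ℙ ¬fz = r-lam ¬fz
      ι-lam {z} 1ℙ ¬fz = trans (lam-∘ (r z) t y) (trans (lam-cong refl ty≈y) (r-lam ¬fz))

      ι-injective₁ : ∀ {z w} j k → ¬ Fix z → ¬ Fix w → ι z j ≈ ι w k → z ≈ w
      ι-injective₁ j k ¬fz ¬fw eq =
        trans (sym (ι-lam j ¬fz)) (trans (lam-cong eq refl) (ι-lam k ¬fw))

      -- Equal transporters have equal targets, so `r w ∘ t` would be `r w`, against `t` not being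
      -- `1#`.
      ι-disjoint : ∀ {z w} → ¬ Fix z → ¬ Fix w → ¬ ι z 0ℙ ≈ ι w 1ℙ
      ι-disjoint {z} {w} ¬fz ¬fw eq = t≉1 (∘.identityʳ-unique (r w) t
        (trans (sym eq) (r-cong (ι-injective₁ 0ℙ 1ℙ ¬fz ¬fw eq))))

      ¬fy+ : ∀ {x} → Fix x → ¬ Fix (y + x)
      ¬fy+ fx fyx = ¬fy (Fix-+ˡ fx fyx)

      h : Carrier → Carrier
      h x with Fix? x
      ... | yes _ = ι (y + x) 1ℙ
      ... | no  _ = ι x 0ℙ

      h-injective : ∀ x x′ → h x ≈ h x′ → x ≈ x′
      h-injective x x′ eq with Fix? x | Fix? x′
      ... | yes fx | yes fx′ = +.∙-cancelˡ y _ _ (ι-injective₁ 1ℙ 1ℙ (¬fy+ fx) (¬fy+ fx′) eq)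
      ... | yes fx | no ¬fx′ = contradiction (sym eq) (ι-disjoint ¬fx′ (¬fy+ fx))
      ... | no ¬fx | yes fx′ = contradiction eq (ι-disjoint ¬fx (¬fy+ fx′))
      ... | no ¬fx | no ¬fx′ = ι-injective₁ 0ℙ 0ℙ ¬fx ¬fx′ eq

      missed : ¬ Fix (- y + a) → ¬ (∃[ x ] h x ≈ ι a 1ℙ)
      missed ¬f-y+a (x , eq) with Fix? x
      -- Comparing targets gives `y + x ≈ a`, so `- y + a` is the fixed point `x`.
      ... | yes fx = ¬f-y+a (Fix-resp (trans (sym (+.\\-leftDividesʳ y x))
                       (+.∙-congˡ (ι-injective₁ 1ℙ 1ℙ (¬fy+ fx) ¬fa eq))) fx)
      ... | no ¬fx = ι-disjoint ¬fx ¬fa eq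

    -- Every moved point is `y` plus an element of `Fix`, so fixing `y` means fixing everything.
    stabilizer⊆Ker : ∀ {y t} → ¬ Fix y → lam t y ≈ y → Ker-lam t
    stabilizer⊆Ker {y} {t} ¬fy ty≈y z with Fix? z
    ... | yes fz = fz t
    ... | no ¬fz = begin
      lam t z                        ≈⟨ lam-cong refl (+.\\-leftDividesˡ y z) ⟨
      lam t (y + (- y + z))          ≈⟨ lam-+ t y _ ⟩
      lam t y + lam t (- y + z)      ≈⟨ +.∙-cong ty≈y (movedCoset ¬fy ¬fz t) ⟩
      y + (- y + z)                  ≈⟨ +.\\-leftDividesˡ y z ⟩
      z                              ∎

  -- The kernel element `e` and its additive conjugation action on `Fix`

  module OneOrbit (oneOrbit : HasExactlyOneVertex Λ) (Ker∩Fix≐0 : (Ker-lam ∩ Fix) ≐ (_≈ 0#)) where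

    private
      transitive : ∀ {y z} → ¬ Fix y → ¬ Fix z → Orbit y z
      transitive = oneOrbit⇒transitive oneOrbit

      coset : ∀ {y} → ¬ Fix y → ∀ {a} → ¬ Fix a → Fix (- y + a)
      coset = movedCoset transitive

      ker∩fix : ∀ {x} → Ker-lam x → Fix x → x ≈ 0#
      ker∩fix kx fx = proj₁ Ker∩Fix≐0 (kx , fx)

      kernelElement : ∃[ e ] Ker-lam e × ¬ Fix e
      kernelElement with oneOrbit⇒moved oneOrbit
      ... | y , ¬fy with nontrivialStabilizer transitive ¬fy
      ... | t , t≉1 , ty≈y = t , kt , λ ft → t≉1 (trans (ker∩fix kt ft) (sym 1≈0))
        where
        kt : Ker-lam t
        kt = stabilizer⊆Ker transitive ¬fy ty≈y

    e : Carrier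
    e = proj₁ kernelElement

    e∈Ker : Ker-lam e
    e∈Ker = proj₁ (proj₂ kernelElement)

    e∉Fix : ¬ Fix e
    e∉Fix = proj₂ (proj₂ kernelElement)

    -- `e` acts trivially, so `e + x` is the product `e ∘ x` of two kernel elements.
    e+Ker : ∀ {x} → Ker-lam x → Ker-lam (e + x)
    e+Ker kx = Ker-resp (Ker-∘ _ e∈Ker) (Ker-comp e∈Ker kx)

    -- Were `e + e` moved, its difference from `e`, which is `e` itself, would be fixed. So it lies
    -- in the kernel and in `Fix`.
    e+e≈0 : e + e ≈ 0#
    e+e≈0 = ker∩fix (e+Ker e∈Ker) (decidable-stable (Fix? (e + e)) λ ¬fee →
      e∉Fix (Fix-resp (+.\\-leftDividesʳ e e) (coset e∉Fix ¬fee)))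

    -e≈e : - e ≈ e
    -e≈e = sym (+.inverseʳ-unique e e e+e≈0)

    e+e+ : ∀ x → e + (e + x) ≈ x
    e+e+ x = trans (sym (+.assoc e e x)) (trans (+.∙-congʳ e+e≈0) (+.identityˡ x))

    -- `e + k` is in the kernel, and it is fixed because it equals `- e + k`; hence it is 0.
    Ker∖Fix≈e : ∀ {k} → Ker-lam k → ¬ Fix k → k ≈ e
    Ker∖Fix≈e {k} kk ¬fk = trans (+.inverseʳ-unique e k (ker∩fix (e+Ker kk)
      (Fix-resp (+.∙-congʳ -e≈e) (coset e∉Fix ¬fk)))) -e≈e

    -- The kernel is normal, so a conjugate of `e` lies in it. The conjugate is not 0, hence it is
    -- moved and must be `e`.
    e-central : ∀ x → x ∘ e ≈ e ∘ x
    e-central x = begin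
      x ∘ e              ≈⟨ ∘.//-rightDividesˡ x (x ∘ e) ⟨
      x ∘ e ∘ x ⁻¹ ∘ x   ≈⟨ ∘.∙-congʳ (Ker∖Fix≈e (Ker-conj x e∈Ker) ¬f) ⟩
      e ∘ x              ∎
      where
      ¬f : ¬ Fix (x ∘ e ∘ x ⁻¹)
      ¬f f = e∉Fix (Fix-resp (sym (trans e≈1 1≈0)) Fix-0)
        where
        e≈1 : e ≈ 1#
        e≈1 = ∘.identityʳ-unique x e (∘.x∙y⁻¹≈ε⇒x≈y _ x
          (trans (ker∩fix (Ker-conj x e∈Ker) f) (sym 1≈0)))

    -- The displacement of `e` under `lam x`.
    φ : Carrier → Carrier
    φ x = - e + lam x e

    φ-Fix : ∀ x → Fix (φ x)
    φ-Fix x = coset e∉Fix λ f → e∉Fix (Fix-lam f)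

    lam-e : ∀ x → lam x e ≈ e + φ x
    lam-e x = sym (+.\\-leftDividesˡ e (lam x e))

    -- For fixed `y` the sum `x + y` is `x ∘ y`, so the actions compose, and `lam x` leaves `φ y`
    -- unchanged.
    φ-+ : ∀ x {y} → Fix y → φ (x + y) ≈ φ x + φ y
    φ-+ x {y} fy = begin
      - e + lam (x + y) e           ≈⟨ +.∙-congˡ (lam-cong (Fix-∘ x fy) refl) ⟨
      - e + lam (x ∘ y) e           ≈⟨ +.∙-congˡ (lam-∘ x y e) ⟩
      - e + lam x (lam y e)         ≈⟨ +.∙-congˡ (lam-cong refl (lam-e y)) ⟩
      - e + lam x (e + φ y)         ≈⟨ +.∙-congˡ (lam-+ x e (φ y)) ⟩
      - e + (lam x e + lam x (φ y)) ≈⟨ +.assoc _ _ _ ⟨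
      φ x + lam x (φ y)             ≈⟨ +.∙-congˡ (φ-Fix y x) ⟩
      φ x + φ y                     ∎

    -- Zero displacement means that `x` stabilizes `e`, hence lies in the kernel.
    φ≈0⇒≈0 : ∀ {x} → Fix x → φ x ≈ 0# → x ≈ 0#
    φ≈0⇒≈0 {x} fx φx≈0 = ker∩fix (stabilizer⊆Ker transitive e∉Fix
      (trans (lam-e x) (trans (+.∙-congˡ φx≈0) (+.identityʳ e)))) fx

    ψ : Carrier → Carrier
    ψ x = x + - φ x

    ψ-Fix : ∀ {x} → Fix x → Fix (ψ x)
    ψ-Fix fx = Fix-+ fx (Fix-neg (φ-Fix _))

    -- This is `x ∘ e ≈ e ∘ x` written additively.
    x+e+φ≈e+x : ∀ x → x + e + φ x ≈ e + x
    x+e+φ≈e+x x = begin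
      x + e + φ x     ≈⟨ +.assoc x e _ ⟩
      x + (e + φ x)   ≈⟨ +.∙-congˡ (lam-e x) ⟨
      x + lam x e     ≈⟨ ∘-lam x e ⟨
      x ∘ e           ≈⟨ e-central x ⟩
      e ∘ x           ≈⟨ Ker-∘ x e∈Ker ⟩
      e + x           ∎

    x+e≈e+ψ : ∀ x → x + e ≈ e + ψ x
    x+e≈e+ψ x = begin
      x + e                    ≈⟨ +.//-rightDividesʳ (φ x) (x + e) ⟨
      x + e + φ x + - φ x      ≈⟨ +.∙-congʳ (x+e+φ≈e+x x) ⟩
      e + x + - φ x            ≈⟨ +.assoc e x _ ⟩
      e + ψ x                  ∎

    -- By `x+e≈e+ψ`, `ψ` is additive conjugation by `e`, and `e + e` is 0.
    ψ-involutive : ∀ x → ψ (ψ x) ≈ x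
    ψ-involutive x = begin
      ψ (ψ x)              ≈⟨ e+e+ _ ⟨
      e + (e + ψ (ψ x))    ≈⟨ +.∙-congˡ (x+e≈e+ψ (ψ x)) ⟨
      e + (ψ x + e)        ≈⟨ +.assoc e _ e ⟨
      e + ψ x + e          ≈⟨ +.∙-congʳ (x+e≈e+ψ x) ⟨
      x + e + e            ≈⟨ +.assoc x e e ⟩
      x + (e + e)          ≈⟨ +.∙-congˡ e+e≈0 ⟩
      x + 0#               ≈⟨ +.identityʳ x ⟩
      x                    ∎

    -- φ (x + ψ x) = φ x + φ (ψ x) vanishes because x = ψ (ψ x) = x - φ x - φ (ψ x).
    ψ≈neg : ∀ {x} → Fix x → ψ x ≈ - x
    ψ≈neg {x} fx = +.inverseʳ-unique x (ψ x) (φ≈0⇒≈0 (Fix-+ fx (ψ-Fix fx)) (begin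
      φ (x + ψ x)     ≈⟨ φ-+ x (ψ-Fix fx) ⟩
      φ x + φ (ψ x)   ≈⟨ +.∙-congˡ φψ≈-φ ⟩
      φ x + - φ x     ≈⟨ +.inverseʳ _ ⟩
      0#              ∎))
      where
      φψ≈-φ : φ (ψ x) ≈ - φ x
      φψ≈-φ = sym (+.x∙y⁻¹≈ε⇒x≈y _ _ (+.identityʳ-unique x _
        (trans (sym (+.assoc x _ _)) (ψ-involutive x))))

    x+e≈e-x : ∀ {x} → Fix x → x + e ≈ e + - x
    x+e≈e-x {x} fx = trans (x+e≈e+ψ x) (+.∙-congˡ (ψ≈neg fx))

    e+x≈-x+e : ∀ {x} → Fix x → e + x ≈ - x + e
    e+x≈-x+e {x} fx = trans (+.∙-congˡ (sym (+.⁻¹-involutive x))) (sym (x+e≈e-x (Fix-neg fx)))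

    -- Cancelling `x` in `x + - φ x ≈ - x` gives `- φ x ≈ - x + - x`; then negate.
    φ≈double : ∀ {x} → Fix x → φ x ≈ x + x
    φ≈double {x} fx = trans (sym (+.⁻¹-involutive _)) (trans (+.⁻¹-cong
      (trans (sym (+.\\-leftDividesʳ x _)) (+.∙-congˡ (ψ≈neg fx))))
      (trans (+.⁻¹-anti-homo-∙ _ _) (+.∙-cong (+.⁻¹-involutive x) (+.⁻¹-involutive x))))

    -- Conjugation by e is negation on Fix, and negation is an endomorphism only of abelian groups.
    Fix-comm : ∀ {x y} → Fix x → Fix y → x + y ≈ y + x
    Fix-comm {x} {y} fx fy = +.⁻¹-injective (trans (+.∙-cancelˡ e _ _ (begin
      e + - (x + y)      ≈⟨ x+e≈e-x (Fix-+ fx fy) ⟨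
      x + y + e          ≈⟨ +.assoc x y e ⟩
      x + (y + e)        ≈⟨ +.∙-congˡ (x+e≈e-x fy) ⟩
      x + (e + - y)      ≈⟨ +.assoc x e _ ⟨
      x + e + - y        ≈⟨ +.∙-congʳ (x+e≈e-x fx) ⟩
      e + - x + - y      ≈⟨ +.assoc e _ _ ⟩
      e + (- x + - y)    ∎)) (sym (+.⁻¹-anti-homo-∙ y x)))

    module FixA = SkewBrace (fixSkewBrace A)

    FixA-isAbelianGroup : IsAbelianGroup FixA._≈_ FixA._+_ FixA.0# FixA.-_
    FixA-isAbelianGroup = record
      { isGroup = FixA.+-isGroup ; comm = λ (_ , fx) (_ , fy) → Fix-comm fx fy }

    -- Negation is an involution fixing only 0: if `- x ≈ x`, then `φ x` is `x + x`, hence 0, and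
    -- `φ` has trivial kernel on `Fix`.
    FixA-odd : HasOddOrder FixA.setoid
    FixA-odd with subset-finite Fix-resp Fix?
    ... | m , Fix↔m = m , Fix↔m ,
      FiniteSetoid.uniqueFixedPoint-involution⇒odd FixA.setoid Fix↔m FixA.-_ +.⁻¹-cong
        (λ (x , _) → +.⁻¹-involutive x) FixA.0# +.ε⁻¹≈ε
        λ (x , fx) -x≈x → φ≈0⇒≈0 fx (begin
          φ x     ≈⟨ φ≈double fx ⟩
          x + x   ≈⟨ +.∙-congʳ -x≈x ⟨
          - x + x ≈⟨ +.inverseˡ x ⟩
          0#      ∎)

    FixA-abelianGroup : AbelianGroup _ _
    FixA-abelianGroup = record { isAbelianGroup = FixA-isAbelianGroup }

    open SignedProduct FixA-abelianGroup using (F×ℤ/2-isSkewBrace; signedProduct)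
    module B = SkewBrace signedProduct

    -- The isomorphism with the signed product

    embed : B.Carrier → Carrier
    embed ((f , _) , 0ℙ) = f
    embed ((f , _) , 1ℙ) = f + e

    embed-cong : ∀ {x y} → x B.≈ y → embed x ≈ embed y
    embed-cong {_ , 0ℙ} (f≈g , ≡.refl) = f≈g
    embed-cong {_ , 1ℙ} (f≈g , ≡.refl) = +.∙-congʳ f≈g

    Fix+e∉Fix : ∀ {x} → Fix x → ¬ Fix (x + e)
    Fix+e∉Fix {x} fx f = e∉Fix (Fix-resp (+.\\-leftDividesʳ x e) (Fix-+ (Fix-neg fx) f))

    embed-injective : ∀ {x y} → embed x ≈ embed y → x B.≈ y
    embed-injective {_ , 0ℙ}        {_ , 0ℙ}        eq = eq , ≡.refl
    embed-injective {(_ , ff) , 0ℙ} {(_ , fg) , 1ℙ} eq =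
      contradiction (Fix-resp eq ff) (Fix+e∉Fix fg)
    embed-injective {(_ , ff) , 1ℙ} {(_ , fg) , 0ℙ} eq =
      contradiction (Fix-resp (sym eq) fg) (Fix+e∉Fix ff)
    embed-injective {_ , 1ℙ}        {_ , 1ℙ}        eq = +.∙-cancelʳ e _ _ eq , ≡.refl

    split : Carrier → B.Carrier
    split a with Fix? a
    ... | yes fa = (a , fa) , 0ℙ
    -- With `d = - e + a` in `Fix`, `a` is `e + d`, and moving `e` to the right turns it into
    -- `- d + e`.
    ... | no ¬fa = (- (- e + a) , Fix-neg (coset e∉Fix ¬fa)) , 1ℙ

    embed-split : ∀ a → embed (split a) ≈ a
    embed-split a with Fix? a
    ... | yes fa = refl
    ... | no ¬fa = trans (sym (e+x≈-x+e (coset e∉Fix ¬fa))) (+.\\-leftDividesˡ e a)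

    -- Moving `e` past an element of `Fix` flips its sign, and two copies of `e` cancel.
    embed-+ : ∀ x y → embed (x B.+ y) ≈ embed x + embed y
    embed-+ ((f , _)  , 0ℙ) ((g , _)  , 0ℙ) = refl
    embed-+ ((f , _)  , 0ℙ) ((g , _)  , 1ℙ) = +.assoc f g e
    embed-+ ((f , _)  , 1ℙ) ((g , fg) , 0ℙ) = begin
      f + - g + e     ≈⟨ +.assoc f _ e ⟩
      f + (- g + e)   ≈⟨ +.∙-congˡ (e+x≈-x+e fg) ⟨
      f + (e + g)     ≈⟨ +.assoc f e g ⟨
      f + e + g       ∎
    embed-+ ((f , _)  , 1ℙ) ((g , fg) , 1ℙ) = begin
      f + - g               ≈⟨ +.∙-congˡ (e+e+ _) ⟨
      f + (e + (e + - g))   ≈⟨ +.∙-congˡ (+.∙-congˡ (x+e≈e-x fg)) ⟨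
      f + (e + (g + e))     ≈⟨ +.assoc f e _ ⟨
      f + e + (g + e)       ∎

    -- Rewrites a point of the moved coset as a `∘`-product, in which `e` is central.
    x+e≈e∘-x : ∀ {x} → Fix x → x + e ≈ e ∘ (- x)
    x+e≈e∘-x fx = trans (x+e≈e-x fx) (sym (Ker-∘ _ e∈Ker))

    neg-+- : ∀ {x y} → Fix x → Fix y → - (x + - y) ≈ - x + y
    neg-+- {x} {y} fx fy = trans (+.⁻¹-anti-homo-// x y) (Fix-comm fy (Fix-neg fx))

    -- Points of the second layer become `e ∘ (- x)`. Centrality collects the copies of `e`, a pair
    -- of which is `1#`, and on `Fix` the product `∘` is `+`.
    embed-∘ : ∀ x y → embed (x B.∘ y) ≈ embed x ∘ embed y
    embed-∘ ((f , _)  , 0ℙ) ((g , fg) , 0ℙ) = sym (Fix-∘ f fg)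
    embed-∘ ((f , ff) , 0ℙ) ((g , fg) , 1ℙ) = begin
      - f + g + e           ≈⟨ x+e≈e∘-x (Fix-+ (Fix-neg ff) fg) ⟩
      e ∘ (- (- f + g))     ≈⟨ ∘.∙-congˡ (+.⁻¹-cong (neg-+- ff fg)) ⟨
      e ∘ (- - (f + - g))   ≈⟨ ∘.∙-congˡ (+.⁻¹-involutive _) ⟩
      e ∘ (f + - g)         ≈⟨ ∘.∙-congˡ (Fix-∘ f (Fix-neg fg)) ⟨
      e ∘ (f ∘ (- g))       ≈⟨ ∘.assoc e f _ ⟨
      e ∘ f ∘ (- g)         ≈⟨ ∘.∙-congʳ (e-central f) ⟨
      f ∘ e ∘ (- g)         ≈⟨ ∘.assoc f e _ ⟩
      f ∘ (e ∘ (- g))       ≈⟨ ∘.∙-congˡ (x+e≈e∘-x fg) ⟨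
      f ∘ (g + e)           ∎
    embed-∘ ((f , ff) , 1ℙ) ((g , fg) , 0ℙ) = begin
      f + - g + e           ≈⟨ x+e≈e∘-x (Fix-+ ff (Fix-neg fg)) ⟩
      e ∘ (- (f + - g))     ≈⟨ ∘.∙-congˡ (neg-+- ff fg) ⟩
      e ∘ (- f + g)         ≈⟨ ∘.∙-congˡ (Fix-∘ (- f) fg) ⟨
      e ∘ ((- f) ∘ g)       ≈⟨ ∘.assoc e _ g ⟨
      e ∘ (- f) ∘ g         ≈⟨ ∘.∙-congʳ (x+e≈e∘-x ff) ⟨
      (f + e) ∘ g           ∎
    embed-∘ ((f , ff) , 1ℙ) ((g , fg) , 1ℙ) = begin
      - f + - g                   ≈⟨ Fix-∘ (- f) (Fix-neg fg) ⟨
      (- f) ∘ (- g)               ≈⟨ ∘.identityˡ _ ⟨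
      1# ∘ ((- f) ∘ (- g))        ≈⟨ ∘.∙-congʳ e∘e≈1 ⟨
      e ∘ e ∘ ((- f) ∘ (- g))     ≈⟨ ∘.assoc e e _ ⟩
      e ∘ (e ∘ ((- f) ∘ (- g)))   ≈⟨ ∘.∙-congˡ (∘.assoc e _ _) ⟨
      e ∘ (e ∘ (- f) ∘ (- g))     ≈⟨ ∘.∙-congˡ (∘.∙-congʳ (e-central (- f))) ⟨
      e ∘ ((- f) ∘ e ∘ (- g))     ≈⟨ ∘.∙-congˡ (∘.assoc _ e _) ⟩
      e ∘ ((- f) ∘ (e ∘ (- g)))   ≈⟨ ∘.assoc e _ _ ⟨
      e ∘ (- f) ∘ (e ∘ (- g))     ≈⟨ ∘.∙-cong (x+e≈e∘-x ff) (x+e≈e∘-x fg) ⟨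
      (f + e) ∘ (g + e)           ∎
      where
      e∘e≈1 : e ∘ e ≈ 1#
      e∘e≈1 = trans (Ker-∘ e e∈Ker) (trans e+e≈0 (sym 1≈0))

    A≅F×ℤ/2 : A ≅ signedProduct
    A≅F×ℤ/2 = split
      , section-isGroupIsomorphism +-group B.+-group
          embed embed-cong embed-+ embed-injective split embed-split
      , section-isGroupIsomorphism ∘-group B.∘-group
          embed embed-cong embed-∘ embed-injective split embed-split

mainTheorem14 : ∀ {c ℓ} →
  ((A : SkewBrace c ℓ) →
   let open SkewBrace A
       module FixA = SkewBrace (fixSkewBrace A)
   in
   Finite setoid →
   HasExactlyOneVertex Λ →
   (Ker-lam ∩ Fix) ≐ (_≈ 0#) →
   IsAbelianGroup FixA._≈_ FixA._+_ FixA.0# FixA.-_ ×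
   HasOddOrder FixA.setoid ×
   FixA.IsTrivial ×
   (Σ[ isSB ∈ IsSkewBrace (F×ℤ/2 FixA.+-rawGroup) ]
     A ≅ mkSkewBrace (F×ℤ/2 FixA.+-rawGroup) isSB))
  ×
  ((F : AbelianGroup c ℓ) →
   let module F = AbelianGroup F in
   HasOddOrder F.setoid →
   (∃[ x ] ¬ (x F.≈ F.ε)) →
   Σ[ isSB ∈ IsSkewBrace (F×ℤ/2 F.rawGroup) ]
     (let open SkewBrace (mkSkewBrace (F×ℤ/2 F.rawGroup) isSB) in
      Fix ≐ (U ⟨×⟩ (_≡ 0ℙ)) ×
      Ker-lam ≐ ((F._≈ F.ε) ⟨×⟩ U) ×
      HasExactlyOneVertex Λ))
mainTheorem14 =
    (λ A (n , A↔n) oneOrbit Ker∩Fix≐0 →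
      let open FiniteSkewBrace.OneOrbit A A↔n oneOrbit Ker∩Fix≐0 in
      FixA-isAbelianGroup , FixA-odd , SkewBraceProperties.fixSkewBrace-isTrivial A ,
      SignedProduct.F×ℤ/2-isSkewBrace FixA-abelianGroup , A≅F×ℤ/2)
  , (λ F (n , F↔n , odd) (x , x≉ε) →
      let open SignedProduct F in
      F×ℤ/2-isSkewBrace , signedProduct-Fix F↔n odd x≉ε , signedProduct-Ker F↔n odd x≉ε ,
      signedProduct-Λ F↔n odd x≉ε)
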